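{- Let $u$ be an entire or meromorphic function on $\mathbb{C}$ and let $A=u(z)\frac{d}{dz}$. Let $P(w)=c_0+c_1w+\dots+c_nw^n$ be a polynomial with complex coefficients. Let $\lambda\in\mathbb{C}$ and let $y=y(z)$ satisfy the equality $Ay=\lambda y$. Then for every $a,b\in\mathbb{C}$ the equality $$P(a+bA)\,y=P(a+b\lambda)\,y$$ holds.
   Context: For a linear differential operator $L$ and a polynomial $P(w)=\sum_{t=0}^n c_tw^t$, $P(L)=\sum_{t=0}^n c_tL^t$, where $L^t$ is the $t$-fold composition and $L^0$ is the identity; $a+bA$ denotes the operator $f\mapsto af+bAf$. Here $y$ is a meromorphic function on some domain of $\mathbb{C}$, and all equalities are equalities of functions on that domain. -}

module Defs where

open import Algebra.Bundles using (CommutativeRing; RawMonoid)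
import Algebra.Definitions.RawMonoid as RawMonoidDefinitions
import Algebra.Properties.Semiring.Exp as Exp
import Algebra.Properties.Semiring.Sum as Sum
import Algebra.Solver.Ring as RingSolver
import Algebra.Solver.Ring.AlmostCommutativeRing as ACR
open import Data.Empty using (⊥-elim)
open import Data.Fin.Base using (toℕ)
open import Data.Maybe.Base using (Maybe; just; nothing)
open import Data.Nat.Base as ℕ using (ℕ; zero; suc)
import Data.Nat.Properties as ℕ
open import Data.Product.Base using (∃; _×_; _,_; proj₁; proj₂)
open import Data.Rational.Base as ℚ using (ℚ; 0ℚ; 1ℚ; ½; positive; nonNegative)
import Data.Rational.Properties as ℚ
open import Data.Sum.Base using (_⊎_; inj₁; inj₂)
open import Data.Unit.Base using (tt)
open import Data.Vec.Functional using (Vector)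
open import Function.Base using (_∘_; _$_)
import Function.Endo.Propositional as Endo
open import Level as Level using (0ℓ)
open import Relation.Binary.Bundles using (Preorder)
open import Relation.Binary.PropositionalEquality as ≡ using (_≡_; refl)
import Relation.Binary.Reasoning.Preorder
open import Relation.Nullary using (yes; no)
open import Relation.Nullary.Decidable.Core using (dec⇒maybe)
open import Relation.Unary using (Pred; _∈_; _⊆_; _∩_; _∪_; U; Satisfiable)
import Tactic.RingSolver as Tactic
import Tactic.RingSolver.Core.AlmostCommutativeRing as TACR

module Rational where

  open import Data.Rational.Base using (_+_; _*_; -_; _-_; _≤_; _<_; ∣_∣)
  open ℚ.≤-Reasoning

  ring : TACR.AlmostCommutativeRing 0ℓ 0ℓ
  ring = TACR.fromCommutativeRing ℚ.+-*-commutativeRing (λ q → dec⇒maybe (0ℚ ℚ.≟ q))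

  0<½ : 0ℚ < ½
  0<½ = ℚ.positive⁻¹ ½

  0<1 : 0ℚ < 1ℚ
  0<1 = ℚ.positive⁻¹ 1ℚ

  +-pos : ∀ {p q} → 0ℚ < p → 0ℚ < q → 0ℚ < p + q
  +-pos {p} {q} 0<p 0<q = ℚ.positive⁻¹ (p + q) {{ℚ.pos+pos⇒pos p {{positive 0<p}} q {{positive 0<q}}}}

  *-pos : ∀ {p q} → 0ℚ < p → 0ℚ < q → 0ℚ < p * q
  *-pos {p} {q} 0<p 0<q = ℚ.positive⁻¹ (p * q) {{ℚ.pos*pos⇒pos p {{positive 0<p}} q {{positive 0<q}}}}

  *-monoˡ : ∀ {p q r} → 0ℚ ≤ r → p ≤ q → r * p ≤ r * q
  *-monoˡ {r = r} 0≤r = ℚ.*-monoˡ-≤-nonNeg r {{nonNegative 0≤r}}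

  *-mono : ∀ {p q r s} → 0ℚ ≤ p → p ≤ q → 0ℚ ≤ r → r ≤ s → p * r ≤ q * s
  *-mono {p} {q} {r} {s} 0≤p p≤q 0≤r r≤s = begin
    p * r  ≤⟨ *-monoˡ 0≤p r≤s ⟩
    p * s  ≡⟨ ℚ.*-comm p s ⟩
    s * p  ≤⟨ *-monoˡ (ℚ.≤-trans 0≤r r≤s) p≤q ⟩
    s * q  ≡⟨ ℚ.*-comm s q ⟩
    q * s  ∎

  half-pos : ∀ {ε} → 0ℚ < ε → 0ℚ < ½ * ε
  half-pos = *-pos 0<½

  halves : ∀ ε → ½ * ε + ½ * ε ≡ ε
  halves ε = ≡.trans (≡.sym (ℚ.*-distribʳ-+ ε ½ ½)) (ℚ.*-identityˡ ε)

  -- ε = η · b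
  split : ∀ {ε b} → 0ℚ < ε → 0ℚ < b → ∃ λ η → 0ℚ < η × η * b ≡ ε
  split {ε} {b} 0<ε 0<b = ε * b⁻¹ , *-pos 0<ε (ℚ.positive⁻¹ b⁻¹ {{ℚ.1/pos⇒pos b}}) , (begin-equality
      ε * b⁻¹ * b    ≡⟨ ℚ.*-assoc ε b⁻¹ b ⟩
      ε * (b⁻¹ * b)  ≡⟨ ≡.cong (ε *_) (ℚ.*-inverseˡ b) ⟩
      ε * 1ℚ         ≡⟨ ℚ.*-identityʳ ε ⟩
      ε              ∎)
    where
    instance
      posb = positive 0<b
      nzb  = ℚ.pos⇒nonZero b
    b⁻¹ = ℚ.1/ b

  p≤∣p∣ : ∀ p → p ≤ ∣ p ∣
  p≤∣p∣ p with ℚ.≤-total 0ℚ p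
  ... | inj₁ 0≤p = ℚ.≤-reflexive (≡.sym (ℚ.0≤p⇒∣p∣≡p 0≤p))
  ... | inj₂ p≤0 = ℚ.≤-trans p≤0 (ℚ.0≤∣p∣ p)

  -p≤∣p∣ : ∀ p → - p ≤ ∣ p ∣
  -p≤∣p∣ p = ℚ.≤-trans (p≤∣p∣ (- p)) (ℚ.≤-reflexive (ℚ.∣-p∣≡∣p∣ p))

  ∣∣-lub : ∀ {p q} → p ≤ q → - p ≤ q → ∣ p ∣ ≤ q
  ∣∣-lub {p} p≤q -p≤q with ℚ.∣p∣≡p∨∣p∣≡-p p
  ... | inj₁ eq = ℚ.≤-trans (ℚ.≤-reflexive eq) p≤q
  ... | inj₂ eq = ℚ.≤-trans (ℚ.≤-reflexive eq) -p≤q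

  square-nonNeg : ∀ p → 0ℚ ≤ p * p
  square-nonNeg p with ℚ.≤-total 0ℚ p
  ... | inj₁ 0≤p = ℚ.≤-trans (ℚ.≤-reflexive (≡.sym (ℚ.*-zeroʳ p))) (*-monoˡ 0≤p 0≤p)
  ... | inj₂ p≤0 = begin
    0ℚ           ≡⟨ ℚ.*-zeroʳ (- p) ⟨
    (- p) * 0ℚ   ≤⟨ *-monoˡ (ℚ.neg-antimono-≤ p≤0) (ℚ.neg-antimono-≤ p≤0) ⟩
    (- p) * (- p) ≡⟨ neg² p ⟩
    p * p        ∎
    where
    neg² : ∀ p → (- p) * (- p) ≡ p * p
    neg² = Tactic.solve-∀ ring

  square-cancel : ∀ {p q} → 0ℚ < q → p * p ≤ q * q → ∣ p ∣ ≤ q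
  square-cancel {p} {q} 0<q pp≤qq with ∣ p ∣ ℚ.≤? q
  ... | yes ∣p∣≤q = ∣p∣≤q
  ... | no ∣p∣≰q = ⊥-elim $ ℚ.<-irrefl refl $ begin-strict
    q * q          <⟨ ℚ.*-monoʳ-<-pos q {{positive 0<q}} q<∣p∣ ⟩
    q * ∣ p ∣      ≡⟨ ℚ.*-comm q ∣ p ∣ ⟩
    ∣ p ∣ * q      ≤⟨ *-monoˡ (ℚ.0≤∣p∣ p) (ℚ.<⇒≤ q<∣p∣) ⟩
    ∣ p ∣ * ∣ p ∣  ≡⟨ ℚ.∣p*q∣≡∣p∣*∣q∣ p p ⟨
    ∣ p * p ∣      ≡⟨ ℚ.0≤p⇒∣p∣≡p (square-nonNeg p) ⟩
    p * p          ≤⟨ pp≤qq ⟩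
    q * q          ∎
    where
    q<∣p∣ = ℚ.≰⇒> ∣p∣≰q

  p≤p+ε : ∀ p {ε} → 0ℚ < ε → p ≤ p + ε
  p≤p+ε p {ε} 0<ε = begin
    p       ≡⟨ ℚ.+-identityʳ p ⟨
    p + 0ℚ  ≤⟨ ℚ.+-monoʳ-≤ p (ℚ.<⇒≤ 0<ε) ⟩
    p + ε   ∎

  0≤q-p⇒p≤q : ∀ {p q} → 0ℚ ≤ q - p → p ≤ q
  0≤q-p⇒p≤q {p} {q} h = begin
    p            ≡⟨ ℚ.+-identityʳ p ⟨
    p + 0ℚ       ≤⟨ ℚ.+-monoʳ-≤ p h ⟩
    p + (q - p)  ≡⟨ eq p q ⟩
    q            ∎
    where
    eq : ∀ p q → p + (q - p) ≡ q
    eq = Tactic.solve-∀ ring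

  p≤q⇒0≤q-p : ∀ {p q} → p ≤ q → 0ℚ ≤ q - p
  p≤q⇒0≤q-p {p} {q} h = begin
    0ℚ     ≡⟨ ℚ.+-inverseʳ p ⟨
    p - p  ≤⟨ ℚ.+-monoˡ-≤ (- p) h ⟩
    q - p  ∎

  -- Families of rationals tending to 0; `late N` is the N-th tail of the index set.
  module Vanishing {I : Set} (late : ℕ → I → Set)
                   (late-mono : ∀ {M N i} → M ℕ.≤ N → late N i → late M i) where

    Eventually : (I → Set) → Set
    Eventually P = ∃ λ N → ∀ i → late N i → P i

    map₂ : ∀ {P Q R : I → Set} → (∀ i → P i → Q i → R i) →
           Eventually P → Eventually Q → Eventually R
    map₂ f (M , p) (N , q) = M ℕ.⊔ N , λ i l →
      f i (p i (late-mono (ℕ.m≤m⊔n M N) l)) (q i (late-mono (ℕ.m≤n⊔m M N) l))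

    map : ∀ {P Q : I → Set} → (∀ i → P i → Q i) → Eventually P → Eventually Q
    map f (N , p) = N , λ i l → f i (p i l)

    Null : (I → ℚ) → Set
    Null s = ∀ ε → 0ℚ < ε → Eventually (λ i → ∣ s i ∣ ≤ ε)

    null-ext : ∀ {s t} → (∀ i → s i ≡ t i) → Null s → Null t
    null-ext eq s→0 ε 0<ε = map (λ i → ≡.subst (λ q → ∣ q ∣ ≤ ε) (eq i)) (s→0 ε 0<ε)

    null-0 : Null (λ _ → 0ℚ)
    null-0 ε 0<ε = 0 , λ _ _ → ℚ.<⇒≤ 0<ε

    null-neg : ∀ {s} → Null s → Null (λ i → - s i)
    null-neg {s} s→0 ε 0<ε = map (λ i → ≡.subst (_≤ ε) (≡.sym (ℚ.∣-p∣≡∣p∣ (s i)))) (s→0 ε 0<ε)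

    null-+ : ∀ {s t} → Null s → Null t → Null (λ i → s i + t i)
    null-+ {s} {t} s→0 t→0 ε 0<ε =
      map₂ (λ i p q → begin
             ∣ s i + t i ∣          ≤⟨ ℚ.∣p+q∣≤∣p∣+∣q∣ (s i) (t i) ⟩
             ∣ s i ∣ + ∣ t i ∣      ≤⟨ ℚ.+-mono-≤ p q ⟩
             ½ * ε + ½ * ε          ≡⟨ halves ε ⟩
             ε                      ∎)
           (s→0 (½ * ε) (half-pos 0<ε)) (t→0 (½ * ε) (half-pos 0<ε))

    null-* : ∀ (s t : I → ℚ) {b} → 0ℚ < b → (∀ i → ∣ s i ∣ ≤ b) → Null t → Null (λ i → s i * t i)
    null-* s t {b} 0<b s≤b t→0 ε 0<ε with split 0<ε 0<b
    ... | η , 0<η , ηb≡ε =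
      map (λ i p → begin
            ∣ s i * t i ∣      ≡⟨ ℚ.∣p*q∣≡∣p∣*∣q∣ (s i) (t i) ⟩
            ∣ s i ∣ * ∣ t i ∣  ≤⟨ *-mono (ℚ.0≤∣p∣ (s i)) (s≤b i) (ℚ.0≤∣p∣ (t i)) p ⟩
            b * η              ≡⟨ ℚ.*-comm b η ⟩
            η * b              ≡⟨ ηb≡ε ⟩
            ε                  ∎)
          (t→0 η 0<η)

module Real where

  open Rational

  -- Cauchy reals: equality of real numbers is the setoid relation _≈_ below.
  record ℝ : Set where
    no-eta-equality
    field
      seq    : ℕ → ℚ
      cauchy : ∀ ε → 0ℚ ℚ.< ε →
               ∃ λ N → ∀ m n → N ℕ.≤ m → N ℕ.≤ n → ℚ.∣ seq m ℚ.- seq n ∣ ℚ.≤ ε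
  open ℝ public

  infix 4 _≈_ _≤_ _<_

  record _≈_ (x y : ℝ) : Set where
    no-eta-equality; pattern
    constructor eq
    field
      close : ∀ ε → 0ℚ ℚ.< ε → ∃ λ N → ∀ n → N ℕ.≤ n → ℚ.∣ seq x n ℚ.- seq y n ∣ ℚ.≤ ε
  open _≈_ public

  record _≤_ (x y : ℝ) : Set where
    no-eta-equality; pattern
    constructor le
    field
      below : ∀ ε → 0ℚ ℚ.< ε → ∃ λ N → ∀ n → N ℕ.≤ n → seq x n ℚ.≤ seq y n ℚ.+ ε
  open _≤_ public

  record _<_ (x y : ℝ) : Set where
    no-eta-equality; pattern
    constructor lt
    field
      gap     : ℚ
      gap-pos : 0ℚ ℚ.< gap
      apart   : ∃ λ N → ∀ n → N ℕ.≤ n → seq x n ℚ.+ gap ℚ.≤ seq y n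

  private
    module V₁ = Vanishing {ℕ} ℕ._≤_ ℕ.≤-trans
    module V₂ = Vanishing {ℕ × ℕ} (λ N (m , n) → N ℕ.≤ m × N ℕ.≤ n)
                  (λ M≤N (p , q) → ℕ.≤-trans M≤N p , ℕ.≤-trans M≤N q)

    to-V₂ : ∀ x → V₂.Null (λ (m , n) → seq x m ℚ.- seq x n)
    to-V₂ x ε 0<ε = let N , h = cauchy x ε 0<ε in N , λ (m , n) (p , q) → h m n p q

    from-V₂ : ∀ (s : ℕ → ℚ) → V₂.Null (λ (m , n) → s m ℚ.- s n) →
              ∀ ε → 0ℚ ℚ.< ε → ∃ λ N → ∀ m n → N ℕ.≤ m → N ℕ.≤ n → ℚ.∣ s m ℚ.- s n ∣ ℚ.≤ ε
    from-V₂ s h ε 0<ε = let N , k = h ε 0<ε in N , λ m n p q → k (m , n) (p , q)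

  bound : ∀ x → ∃ λ b → 0ℚ ℚ.< b × ∀ n → ℚ.∣ seq x n ∣ ℚ.≤ b
  bound x = B N ℚ.+ 1ℚ , 0<b , all
    where
    open ℚ.≤-Reasoning
    N = proj₁ (cauchy x 1ℚ 0<1)
    B : ℕ → ℚ
    B zero    = ℚ.∣ seq x 0 ∣
    B (suc k) = B k ℚ.+ ℚ.∣ seq x (suc k) ∣
    0≤B : ∀ k → 0ℚ ℚ.≤ B k
    0≤B zero = ℚ.0≤∣p∣ (seq x 0)
    0≤B (suc k) = ℚ.+-mono-≤ (0≤B k) (ℚ.0≤∣p∣ (seq x (suc k)))
    top : ∀ k → ℚ.∣ seq x k ∣ ℚ.≤ B k
    top zero    = ℚ.≤-refl
    top (suc k) = begin
      ℚ.∣ seq x (suc k) ∣           ≡⟨ ℚ.+-identityˡ _ ⟨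
      0ℚ ℚ.+ ℚ.∣ seq x (suc k) ∣    ≤⟨ ℚ.+-monoˡ-≤ _ (0≤B k) ⟩
      B k ℚ.+ ℚ.∣ seq x (suc k) ∣   ∎
    B-mono : ∀ {k l} → k ℕ.≤′ l → B k ℚ.≤ B l
    B-mono ℕ.≤′-refl = ℚ.≤-refl
    B-mono {k} {suc l} (ℕ.≤′-step k≤l) = begin
      B k                          ≤⟨ B-mono k≤l ⟩
      B l                          ≡⟨ ℚ.+-identityʳ _ ⟨
      B l ℚ.+ 0ℚ                   ≤⟨ ℚ.+-monoʳ-≤ (B l) (ℚ.0≤∣p∣ _) ⟩
      B l ℚ.+ ℚ.∣ seq x (suc l) ∣  ∎
    0<b : 0ℚ ℚ.< B N ℚ.+ 1ℚ
    0<b = ℚ.+-mono-≤-< (0≤B N) 0<1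
    regroup : ∀ p q → p ≡ q ℚ.+ (p ℚ.- q)
    regroup = Tactic.solve-∀ ring
    all : ∀ n → ℚ.∣ seq x n ∣ ℚ.≤ B N ℚ.+ 1ℚ
    all n with ℕ.≤-total n N
    ... | inj₁ n≤N = begin
      ℚ.∣ seq x n ∣  ≤⟨ top n ⟩
      B n            ≤⟨ B-mono (ℕ.≤⇒≤′ n≤N) ⟩
      B N            ≡⟨ ℚ.+-identityʳ _ ⟨
      B N ℚ.+ 0ℚ     ≤⟨ ℚ.+-monoʳ-≤ (B N) (ℚ.<⇒≤ 0<1) ⟩
      B N ℚ.+ 1ℚ     ∎
    ... | inj₂ N≤n = begin
      ℚ.∣ seq x n ∣                                        ≡⟨ ≡.cong ℚ.∣_∣ (regroup (seq x n) (seq x N)) ⟩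
      ℚ.∣ seq x N ℚ.+ (seq x n ℚ.- seq x N) ∣              ≤⟨ ℚ.∣p+q∣≤∣p∣+∣q∣ (seq x N) (seq x n ℚ.- seq x N) ⟩
      ℚ.∣ seq x N ∣ ℚ.+ ℚ.∣ seq x n ℚ.- seq x N ∣          ≤⟨ ℚ.+-mono-≤ (top N) (proj₂ (cauchy x 1ℚ 0<1) n N N≤n ℕ.≤-refl) ⟩
      B N ℚ.+ 1ℚ                                           ∎

  infixl 6 _+_ _-_
  infixl 7 _*_
  infix  8 -_

  ι : ℚ → ℝ
  ι q .seq _ = q
  ι q .cauchy = from-V₂ (λ _ → q) (V₂.null-ext (λ _ → ≡.sym (ℚ.+-inverseʳ q)) V₂.null-0)

  _+_ : ℝ → ℝ → ℝ
  (x + y) .seq n = seq x n ℚ.+ seq y n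
  (x + y) .cauchy = from-V₂ (seq (x + y)) (V₂.null-ext (λ (m , n) → lem (seq x m) (seq x n) (seq y m) (seq y n)) (V₂.null-+ (to-V₂ x) (to-V₂ y)))
    where
    lem : ∀ a b c d → (a ℚ.- b) ℚ.+ (c ℚ.- d) ≡ (a ℚ.+ c) ℚ.- (b ℚ.+ d)
    lem = Tactic.solve-∀ ring

  _*_ : ℝ → ℝ → ℝ
  (x * y) .seq n = seq x n ℚ.* seq y n
  (x * y) .cauchy =
    let b , 0<b , x≤b = bound x ; c , 0<c , y≤c = bound y in
    from-V₂ (seq (x * y)) (V₂.null-ext (λ (m , n) → lem (seq x m) (seq x n) (seq y m) (seq y n))
      (V₂.null-+ (V₂.null-* (λ (m , n) → seq x m) (λ (m , n) → seq y m ℚ.- seq y n) 0<b (λ (m , n) → x≤b m) (to-V₂ y))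
                 (V₂.null-* (λ (m , n) → seq y n) (λ (m , n) → seq x m ℚ.- seq x n) 0<c (λ (m , n) → y≤c n) (to-V₂ x))))
    where
    lem : ∀ a b c d → a ℚ.* (c ℚ.- d) ℚ.+ d ℚ.* (a ℚ.- b) ≡ a ℚ.* c ℚ.- b ℚ.* d
    lem = Tactic.solve-∀ ring

  -_ : ℝ → ℝ
  (- x) .seq n = ℚ.- seq x n
  (- x) .cauchy = from-V₂ (seq (- x)) (V₂.null-ext (λ (m , n) → lem (seq x m) (seq x n)) (V₂.null-neg (to-V₂ x)))
    where
    lem : ∀ a b → ℚ.- (a ℚ.- b) ≡ (ℚ.- a) ℚ.- (ℚ.- b)
    lem = Tactic.solve-∀ ring

  _-_ : ℝ → ℝ → ℝ
  x - y = x + (- y)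

  0ᴿ 1ᴿ : ℝ
  0ᴿ = ι 0ℚ
  1ᴿ = ι 1ℚ

  pointwise : ∀ {x y} → (∀ n → seq x n ≡ seq y n) → x ≈ y
  pointwise {x} {y} h = eq (V₁.null-ext (λ n → ≡.trans (≡.sym (ℚ.+-inverseʳ (seq x n))) (≡.cong (λ q → seq x n ℚ.- q) (h n))) V₁.null-0)

  ≈-refl : ∀ {x} → x ≈ x
  ≈-refl = pointwise (λ _ → refl)

  ≈-sym : ∀ {x y} → x ≈ y → y ≈ x
  ≈-sym {x} {y} p = eq (V₁.null-ext (λ n → lem (seq x n) (seq y n)) (V₁.null-neg (close p)))
    where
    lem : ∀ a b → ℚ.- (a ℚ.- b) ≡ b ℚ.- a
    lem = Tactic.solve-∀ ring

  ≈-trans : ∀ {x y z} → x ≈ y → y ≈ z → x ≈ z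
  ≈-trans {x} {y} {z} p q = eq (V₁.null-ext (λ n → lem (seq x n) (seq y n) (seq z n)) (V₁.null-+ (close p) (close q)))
    where
    lem : ∀ a b c → (a ℚ.- b) ℚ.+ (b ℚ.- c) ≡ a ℚ.- c
    lem = Tactic.solve-∀ ring

  +-cong : ∀ {x y u v} → x ≈ y → u ≈ v → x + u ≈ y + v
  +-cong {x} {y} {u} {v} p q = eq (V₁.null-ext (λ n → lem (seq x n) (seq y n) (seq u n) (seq v n)) (V₁.null-+ (close p) (close q)))
    where
    lem : ∀ a b c d → (a ℚ.- b) ℚ.+ (c ℚ.- d) ≡ (a ℚ.+ c) ℚ.- (b ℚ.+ d)
    lem = Tactic.solve-∀ ring

  -‿cong : ∀ {x y} → x ≈ y → - x ≈ - y
  -‿cong {x} {y} p = eq (V₁.null-ext (λ n → lem (seq x n) (seq y n)) (V₁.null-neg (close p)))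
    where
    lem : ∀ a b → ℚ.- (a ℚ.- b) ≡ (ℚ.- a) ℚ.- (ℚ.- b)
    lem = Tactic.solve-∀ ring

  *-cong : ∀ {x y u v} → x ≈ y → u ≈ v → x * u ≈ y * v
  *-cong {x} {y} {u} {v} p q =
    let b , 0<b , x≤b = bound x ; c , 0<c , v≤c = bound v in
    eq (V₁.null-ext (λ n → lem (seq x n) (seq y n) (seq u n) (seq v n))
      (V₁.null-+ (V₁.null-* (seq x) (λ n → seq u n ℚ.- seq v n) 0<b x≤b (close q))
                 (V₁.null-* (seq v) (λ n → seq x n ℚ.- seq y n) 0<c v≤c (close p))))
    where
    lem : ∀ a b c d → a ℚ.* (c ℚ.- d) ℚ.+ d ℚ.* (a ℚ.- b) ≡ a ℚ.* c ℚ.- b ℚ.* d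
    lem = Tactic.solve-∀ ring

  +-assoc : ∀ x y z → (x + y) + z ≈ x + (y + z)
  +-assoc x y z = pointwise (λ n → ℚ.+-assoc (seq x n) (seq y n) (seq z n))

  +-comm : ∀ x y → x + y ≈ y + x
  +-comm x y = pointwise (λ n → ℚ.+-comm (seq x n) (seq y n))

  +-identityˡ : ∀ x → 0ᴿ + x ≈ x
  +-identityˡ x = pointwise (λ n → ℚ.+-identityˡ (seq x n))

  +-identityʳ : ∀ x → x + 0ᴿ ≈ x
  +-identityʳ x = pointwise (λ n → ℚ.+-identityʳ (seq x n))

  +-inverseˡ : ∀ x → - x + x ≈ 0ᴿ
  +-inverseˡ x = pointwise (λ n → ℚ.+-inverseˡ (seq x n))

  +-inverseʳ : ∀ x → x + - x ≈ 0ᴿ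
  +-inverseʳ x = pointwise (λ n → ℚ.+-inverseʳ (seq x n))

  *-assoc : ∀ x y z → (x * y) * z ≈ x * (y * z)
  *-assoc x y z = pointwise (λ n → ℚ.*-assoc (seq x n) (seq y n) (seq z n))

  *-comm : ∀ x y → x * y ≈ y * x
  *-comm x y = pointwise (λ n → ℚ.*-comm (seq x n) (seq y n))

  *-identityˡ : ∀ x → 1ᴿ * x ≈ x
  *-identityˡ x = pointwise (λ n → ℚ.*-identityˡ (seq x n))

  *-identityʳ : ∀ x → x * 1ᴿ ≈ x
  *-identityʳ x = pointwise (λ n → ℚ.*-identityʳ (seq x n))

  distribˡ : ∀ x y z → x * (y + z) ≈ x * y + x * z
  distribˡ x y z = pointwise (λ n → ℚ.*-distribˡ-+ (seq x n) (seq y n) (seq z n))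

  distribʳ : ∀ x y z → (y + z) * x ≈ y * x + z * x
  distribʳ x y z = pointwise (λ n → ℚ.*-distribʳ-+ (seq x n) (seq y n) (seq z n))

  commutativeRing : CommutativeRing 0ℓ 0ℓ
  commutativeRing = record
    { Carrier = ℝ ; _≈_ = _≈_ ; _+_ = _+_ ; _*_ = _*_ ; -_ = -_ ; 0# = 0ᴿ ; 1# = 1ᴿ
    ; isCommutativeRing = record
      { isRing = record
        { +-isAbelianGroup = record
          { isGroup = record
            { isMonoid = record
              { isSemigroup = record
                { isMagma = record
                  { isEquivalence = record { refl = ≈-refl ; sym = ≈-sym ; trans = ≈-trans }
                  ; ∙-cong = +-cong }
                ; assoc = +-assoc }
              ; identity = +-identityˡ , +-identityʳ }
            ; inverse = +-inverseˡ , +-inverseʳ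
            ; ⁻¹-cong = -‿cong }
          ; comm = +-comm }
        ; *-cong = *-cong
        ; *-assoc = *-assoc
        ; *-identity = *-identityˡ , *-identityʳ
        ; distrib = distribˡ , distribʳ }
      ; *-comm = *-comm } }

  almostRing : ACR.AlmostCommutativeRing 0ℓ 0ℓ
  almostRing = ACR.fromCommutativeRing commutativeRing

  ι-morphism : CommutativeRing.rawRing ℚ.+-*-commutativeRing ACR.-Raw-AlmostCommutative⟶ almostRing
  ι-morphism = record
    { ⟦_⟧ = ι
    ; +-homo = λ _ _ → pointwise (λ _ → refl) ; *-homo = λ _ _ → pointwise (λ _ → refl)
    ; -‿homo = λ _ → pointwise (λ _ → refl)
    ; 0-homo = pointwise (λ _ → refl) ; 1-homo = pointwise (λ _ → refl) }

  decide : ∀ p q → Maybe (ι p ≈ ι q)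
  decide p q with p ℚ.≟ q
  ... | yes refl = just ≈-refl
  ... | no  _    = nothing

  module Solver = RingSolver (CommutativeRing.rawRing ℚ.+-*-commutativeRing) almostRing ι-morphism decide

  open ℚ.≤-Reasoning

  ≤-reflexive : ∀ {x y} → x ≈ y → x ≤ y
  ≤-reflexive {x} {y} x≈y = le λ ε 0<ε → V₁.map
    (λ n h → begin
      seq x n                                ≡⟨ lem (seq x n) (seq y n) ⟩
      seq y n ℚ.+ (seq x n ℚ.- seq y n)      ≤⟨ ℚ.+-monoʳ-≤ (seq y n) (ℚ.≤-trans (p≤∣p∣ _) h) ⟩
      seq y n ℚ.+ ε                          ∎)
    (close x≈y ε 0<ε)
    where
    lem : ∀ p q → p ≡ q ℚ.+ (p ℚ.- q)
    lem = Tactic.solve-∀ ring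

  ≤-refl : ∀ {x} → x ≤ x
  ≤-refl = ≤-reflexive ≈-refl

  ≤-trans : ∀ {x y z} → x ≤ y → y ≤ z → x ≤ z
  ≤-trans {x} {y} {z} x≤y y≤z = le λ ε 0<ε → V₁.map₂
    (λ n h k → begin
      seq x n                              ≤⟨ h ⟩
      seq y n ℚ.+ ½ ℚ.* ε                  ≤⟨ ℚ.+-monoˡ-≤ (½ ℚ.* ε) k ⟩
      seq z n ℚ.+ ½ ℚ.* ε ℚ.+ ½ ℚ.* ε      ≡⟨ ℚ.+-assoc (seq z n) _ _ ⟩
      seq z n ℚ.+ (½ ℚ.* ε ℚ.+ ½ ℚ.* ε)    ≡⟨ ≡.cong (seq z n ℚ.+_) (halves ε) ⟩
      seq z n ℚ.+ ε                        ∎)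
    (below x≤y (½ ℚ.* ε) (half-pos 0<ε)) (below y≤z (½ ℚ.* ε) (half-pos 0<ε))

  ≤-preorder : Preorder 0ℓ 0ℓ 0ℓ
  ≤-preorder = record
    { Carrier = ℝ ; _≈_ = _≈_ ; _≲_ = _≤_
    ; isPreorder = record
      { isEquivalence = CommutativeRing.isEquivalence commutativeRing
      ; reflexive = ≤-reflexive ; trans = ≤-trans } }

  module ≲-Reasoning = Relation.Binary.Reasoning.Preorder ≤-preorder

  +-mono-≤ : ∀ {x y u v} → x ≤ y → u ≤ v → x + u ≤ y + v
  +-mono-≤ {x} {y} {u} {v} x≤y u≤v = le λ ε 0<ε → V₁.map₂
    (λ n h k → begin
      seq x n ℚ.+ seq u n                                    ≤⟨ ℚ.+-mono-≤ h k ⟩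
      (seq y n ℚ.+ ½ ℚ.* ε) ℚ.+ (seq v n ℚ.+ ½ ℚ.* ε)        ≡⟨ lem (seq y n) (½ ℚ.* ε) (seq v n) ⟩
      (seq y n ℚ.+ seq v n) ℚ.+ (½ ℚ.* ε ℚ.+ ½ ℚ.* ε)        ≡⟨ ≡.cong (seq y n ℚ.+ seq v n ℚ.+_) (halves ε) ⟩
      (seq y n ℚ.+ seq v n) ℚ.+ ε                            ∎)
    (below x≤y (½ ℚ.* ε) (half-pos 0<ε)) (below u≤v (½ ℚ.* ε) (half-pos 0<ε))
    where
    lem : ∀ a b c → (a ℚ.+ b) ℚ.+ (c ℚ.+ b) ≡ (a ℚ.+ c) ℚ.+ (b ℚ.+ b)
    lem = Tactic.solve-∀ ring

  -- For p ≥ -η and q ≥ -η, expand (p + η) (q + η) ≥ 0.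
  *-nonNeg : ∀ {x y} → 0ᴿ ≤ x → 0ᴿ ≤ y → 0ᴿ ≤ x * y
  *-nonNeg {x} {y} 0≤x 0≤y =
    let b , 0<b , x≤b = bound x ; c , 0<c , y≤c = bound y in
    le λ ε 0<ε →
      let η , 0<η , ηB≡ε = split 0<ε (+-pos (+-pos 0<b 0<c) 0<1) in go b c 0<b 0<c x≤b y≤c ε η 0<η ηB≡ε
    where
    go : ∀ b c → 0ℚ ℚ.< b → 0ℚ ℚ.< c → (∀ n → ℚ.∣ seq x n ∣ ℚ.≤ b) → (∀ n → ℚ.∣ seq y n ∣ ℚ.≤ c) →
         ∀ ε η → 0ℚ ℚ.< η → η ℚ.* (b ℚ.+ c ℚ.+ 1ℚ) ≡ ε →
         ∃ λ N → ∀ n → N ℕ.≤ n → 0ℚ ℚ.≤ seq x n ℚ.* seq y n ℚ.+ ε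
    go b c 0<b 0<c x≤b y≤c ε η′ 0<η′ η′B≡ε = V₁.map₂ step (below 0≤x η 0<η) (below 0≤y η 0<η)
      where
      η = η′ ℚ.⊓ 1ℚ
      0<η : 0ℚ ℚ.< η
      0<η with ℚ.⊓-sel η′ 1ℚ
      ... | inj₁ e = ≡.subst (0ℚ ℚ.<_) (≡.sym e) 0<η′
      ... | inj₂ e = ≡.subst (0ℚ ℚ.<_) (≡.sym e) 0<1
      expand : ∀ p q e → (p ℚ.+ e) ℚ.* (q ℚ.+ e) ≡ p ℚ.* q ℚ.+ e ℚ.* (p ℚ.+ q ℚ.+ e)
      expand = Tactic.solve-∀ ring
      step : ∀ n → 0ℚ ℚ.≤ seq x n ℚ.+ η → 0ℚ ℚ.≤ seq y n ℚ.+ η → 0ℚ ℚ.≤ seq x n ℚ.* seq y n ℚ.+ ε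
      step n h k = begin
        0ℚ                                             ≡⟨ ℚ.*-zeroʳ (p ℚ.+ η) ⟨
        (p ℚ.+ η) ℚ.* 0ℚ                               ≤⟨ *-monoˡ h k ⟩
        (p ℚ.+ η) ℚ.* (q ℚ.+ η)                        ≡⟨ expand p q η ⟩
        p ℚ.* q ℚ.+ η ℚ.* (p ℚ.+ q ℚ.+ η)              ≤⟨ ℚ.+-monoʳ-≤ (p ℚ.* q) (*-monoˡ (ℚ.<⇒≤ 0<η) p+q+η≤B) ⟩
        p ℚ.* q ℚ.+ η ℚ.* (b ℚ.+ c ℚ.+ 1ℚ)             ≤⟨ ℚ.+-monoʳ-≤ (p ℚ.* q) (*-mono (ℚ.<⇒≤ 0<η) (ℚ.p⊓q≤p η′ 1ℚ) 0≤B ℚ.≤-refl) ⟩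
        p ℚ.* q ℚ.+ η′ ℚ.* (b ℚ.+ c ℚ.+ 1ℚ)            ≡⟨ ≡.cong (p ℚ.* q ℚ.+_) η′B≡ε ⟩
        p ℚ.* q ℚ.+ ε                                  ∎
        where
        p = seq x n
        q = seq y n
        0≤B = ℚ.<⇒≤ (+-pos (+-pos 0<b 0<c) 0<1)
        p+q+η≤B : p ℚ.+ q ℚ.+ η ℚ.≤ b ℚ.+ c ℚ.+ 1ℚ
        p+q+η≤B = ℚ.+-mono-≤ (ℚ.+-mono-≤ (ℚ.≤-trans (p≤∣p∣ p) (x≤b n)) (ℚ.≤-trans (p≤∣p∣ q) (y≤c n))) (ℚ.p⊓q≤q η′ 1ℚ)

  square-nonNegᴿ : ∀ x → 0ᴿ ≤ x * x
  square-nonNegᴿ x = le λ ε 0<ε → 0 , λ n _ → begin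
    0ℚ                          ≤⟨ square-nonNeg (seq x n) ⟩
    seq x n ℚ.* seq x n         ≤⟨ p≤p+ε _ 0<ε ⟩
    seq x n ℚ.* seq x n ℚ.+ ε   ∎

  square-zero : ∀ {x} → x * x ≤ 0ᴿ → x ≈ 0ᴿ
  square-zero {x} xx≤0 = eq λ ε 0<ε → V₁.map
    (λ n h → square-cancel 0<ε (begin
      (seq x n ℚ.- 0ℚ) ℚ.* (seq x n ℚ.- 0ℚ)  ≡⟨ lem (seq x n) ⟩
      seq x n ℚ.* seq x n                    ≤⟨ h ⟩
      0ℚ ℚ.+ ε ℚ.* ε                         ≡⟨ ℚ.+-identityˡ _ ⟩
      ε ℚ.* ε                                ∎))
    (below xx≤0 (ε ℚ.* ε) (*-pos 0<ε 0<ε))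
    where
    lem : ∀ p → (p ℚ.- 0ℚ) ℚ.* (p ℚ.- 0ℚ) ≡ p ℚ.* p
    lem = Tactic.solve-∀ ring

  ι-mono-≤ : ∀ {p q} → p ℚ.≤ q → ι p ≤ ι q
  ι-mono-≤ {p} {q} p≤q = le λ ε 0<ε → 0 , λ n _ → begin
    p          ≤⟨ p≤q ⟩
    q          ≤⟨ p≤p+ε _ 0<ε ⟩
    q ℚ.+ ε    ∎

  ι-mono-< : ∀ {p q} → p ℚ.< q → ι p < ι q
  ι-mono-< {p} {q} p<q = lt (q ℚ.- p) 0<q-p (0 , λ n _ → ℚ.≤-reflexive (lem p q))
    where
    lem : ∀ p q → p ℚ.+ (q ℚ.- p) ≡ q
    lem = Tactic.solve-∀ ring
    0<q-p : 0ℚ ℚ.< q ℚ.- p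
    0<q-p = ≡.subst (ℚ._< q ℚ.- p) (ℚ.+-inverseʳ p) (ℚ.+-monoˡ-< (ℚ.- p) p<q)

  bounded : ∀ x → ∃ λ b → 0ℚ ℚ.< b × x ≤ ι b
  bounded x with bound x
  ... | b , 0<b , x≤b = b , 0<b , le λ ε 0<ε → 0 , λ n _ → begin
    seq x n  ≤⟨ ℚ.≤-trans (p≤∣p∣ _) (x≤b n) ⟩
    b        ≤⟨ p≤p+ε _ 0<ε ⟩
    b ℚ.+ ε  ∎

  ≤-limit : ∀ {x y} → (∀ ε → 0ℚ ℚ.< ε → x ≤ y + ι ε) → x ≤ y
  ≤-limit {x} {y} h = le λ ε 0<ε → V₁.map
    (λ n k → begin
      seq x n                              ≤⟨ k ⟩
      seq y n ℚ.+ ½ ℚ.* ε ℚ.+ ½ ℚ.* ε      ≡⟨ ℚ.+-assoc (seq y n) _ _ ⟩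
      seq y n ℚ.+ (½ ℚ.* ε ℚ.+ ½ ℚ.* ε)    ≡⟨ ≡.cong (seq y n ℚ.+_) (halves ε) ⟩
      seq y n ℚ.+ ε                        ∎)
    (below (h (½ ℚ.* ε) (half-pos 0<ε)) (½ ℚ.* ε) (half-pos 0<ε))

  <⇒≤ : ∀ {x y} → x < y → x ≤ y
  <⇒≤ {x} {y} (lt g 0<g (N , h)) = le λ ε 0<ε → N , λ n l → begin
    seq x n          ≤⟨ p≤p+ε _ 0<g ⟩
    seq x n ℚ.+ g    ≤⟨ h n l ⟩
    seq y n          ≤⟨ p≤p+ε _ 0<ε ⟩
    seq y n ℚ.+ ε    ∎

  <-gap : ∀ {x y} → x < y → ∃ λ g → 0ℚ ℚ.< g × x + ι g ≤ y
  <-gap {x} {y} (lt g 0<g (N , h)) = g , 0<g , le λ ε 0<ε → N , λ n l → begin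
    seq x n ℚ.+ g    ≤⟨ h n l ⟩
    seq y n          ≤⟨ p≤p+ε _ 0<ε ⟩
    seq y n ℚ.+ ε    ∎

  gap-< : ∀ {x y g} → 0ℚ ℚ.< g → x + ι g ≤ y → x < y
  gap-< {x} {y} {g} 0<g h = lt (½ ℚ.* g) (half-pos 0<g) (V₁.map
    (λ n k → begin
      seq x n ℚ.+ ½ ℚ.* g                                            ≡⟨ lem₁ (seq x n) (½ ℚ.* g) ⟩
      seq x n ℚ.+ (½ ℚ.* g ℚ.+ ½ ℚ.* g) ℚ.- ½ ℚ.* g                  ≡⟨ ≡.cong (λ e → seq x n ℚ.+ e ℚ.- ½ ℚ.* g) (halves g) ⟩
      seq x n ℚ.+ g ℚ.- ½ ℚ.* g                                      ≤⟨ ℚ.+-monoˡ-≤ _ k ⟩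
      seq y n ℚ.+ ½ ℚ.* g ℚ.- ½ ℚ.* g                                ≡⟨ lem₂ (seq y n) (½ ℚ.* g) ⟩
      seq y n                                                        ∎)
    (below h (½ ℚ.* g) (half-pos 0<g)))
    where
    lem₁ : ∀ p e → p ℚ.+ e ≡ p ℚ.+ (e ℚ.+ e) ℚ.- e
    lem₁ = Tactic.solve-∀ ring
    lem₂ : ∀ p e → p ℚ.+ e ℚ.- e ≡ p
    lem₂ = Tactic.solve-∀ ring

  +-nonNeg : ∀ {x y} → 0ᴿ ≤ x → 0ᴿ ≤ y → 0ᴿ ≤ x + y
  +-nonNeg 0≤x 0≤y = ≤-trans (≤-reflexive (≈-sym (+-identityˡ 0ᴿ))) (+-mono-≤ 0≤x 0≤y)

  0≤y-x⇒x≤y : ∀ {x y} → 0ᴿ ≤ y - x → x ≤ y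
  0≤y-x⇒x≤y {x} {y} h = ≤-trans (≤-reflexive (≈-sym (+-identityʳ x)))
    (≤-trans (+-mono-≤ (≤-refl {x}) h) (≤-reflexive (solve 2 (λ x y → x :+ (y :- x) := y) ≈-refl x y)))
    where open Solver

  x≤y⇒0≤y-x : ∀ {x y} → x ≤ y → 0ᴿ ≤ y - x
  x≤y⇒0≤y-x {x} {y} h = ≤-trans (≤-reflexive (≈-sym (+-inverseʳ x))) (+-mono-≤ h (≤-refl { - x }))

  *-mono-≤ˡ : ∀ {r x y} → 0ᴿ ≤ r → x ≤ y → r * x ≤ r * y
  *-mono-≤ˡ {r} {x} {y} 0≤r x≤y = 0≤y-x⇒x≤y (≤-trans (*-nonNeg 0≤r (x≤y⇒0≤y-x x≤y))
    (≤-reflexive (solve 3 (λ r x y → r :* (y :- x) := r :* y :- r :* x) ≈-refl r x y)))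
    where open Solver

  *-mono-≤ : ∀ {x y u v} → 0ᴿ ≤ x → x ≤ y → 0ᴿ ≤ u → u ≤ v → x * u ≤ y * v
  *-mono-≤ {x} {y} {u} {v} 0≤x x≤y 0≤u u≤v = ≤-trans (*-mono-≤ˡ 0≤x u≤v)
    (≤-trans (≤-reflexive (*-comm x v)) (≤-trans (*-mono-≤ˡ (≤-trans 0≤u u≤v) x≤y) (≤-reflexive (*-comm v y))))

  ≤-<-trans : ∀ {x y z} → x ≤ y → y < z → x < z
  ≤-<-trans x≤y y<z with <-gap y<z
  ... | g , 0<g , h = gap-< 0<g (≤-trans (+-mono-≤ x≤y ≤-refl) h)

  <-≤-trans : ∀ {x y z} → x < y → y ≤ z → x < z
  <-≤-trans x<y y≤z with <-gap x<y
  ... | g , 0<g , h = gap-< 0<g (≤-trans h y≤z)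

  ι-+ : ∀ p q → ι (p ℚ.+ q) ≈ ι p + ι q
  ι-+ p q = pointwise (λ _ → refl)

  ι-* : ∀ p q → ι (p ℚ.* q) ≈ ι p * ι q
  ι-* p q = pointwise (λ _ → refl)

  ι-nonNeg : ∀ {p} → 0ℚ ℚ.≤ p → 0ᴿ ≤ ι p
  ι-nonNeg = ι-mono-≤

module Complex where

  module R = Real
  open Real using (ℝ; ι; 0ᴿ; 1ᴿ)

  record ℂ : Set where
    no-eta-equality
    field
      re im : ℝ
  open ℂ public

  infix 4 _≈_
  record _≈_ (z w : ℂ) : Set where
    no-eta-equality; pattern
    constructor eq
    field
      re-≈ : re z R.≈ re w
      im-≈ : im z R.≈ im w

  infixl 6 _+_ _-_
  infixl 7 _*_
  infix  8 -_

  ι₂ : ℚ → ℂ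
  ι₂ q .re = ι q
  ι₂ q .im = 0ᴿ

  0ᶜ 1ᶜ : ℂ
  0ᶜ = ι₂ 0ℚ
  1ᶜ = ι₂ 1ℚ

  _+_ _*_ : ℂ → ℂ → ℂ
  (z + w) .re = re z R.+ re w
  (z + w) .im = im z R.+ im w

  (z * w) .re = re z R.* re w R.- im z R.* im w
  (z * w) .im = re z R.* im w R.+ im z R.* re w

  -_ : ℂ → ℂ
  (- z) .re = R.- re z
  (- z) .im = R.- im z

  _-_ : ℂ → ℂ → ℂ
  z - w = z + (- w)

  ≈-refl : ∀ {z} → z ≈ z
  ≈-refl = eq R.≈-refl R.≈-refl

  ≈-sym : ∀ {z w} → z ≈ w → w ≈ z
  ≈-sym (eq p q) = eq (R.≈-sym p) (R.≈-sym q)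

  ≈-trans : ∀ {x y z} → x ≈ y → y ≈ z → x ≈ z
  ≈-trans (eq p q) (eq r s) = eq (R.≈-trans p r) (R.≈-trans q s)

  +-cong : ∀ {x y u v} → x ≈ y → u ≈ v → x + u ≈ y + v
  +-cong (eq p q) (eq r s) = eq (R.+-cong p r) (R.+-cong q s)

  -‿cong : ∀ {x y} → x ≈ y → - x ≈ - y
  -‿cong (eq p q) = eq (R.-‿cong p) (R.-‿cong q)

  *-cong : ∀ {x y u v} → x ≈ y → u ≈ v → x * u ≈ y * v
  *-cong (eq p q) (eq r s) = eq
    (R.+-cong (R.*-cong p r) (R.-‿cong (R.*-cong q s)))
    (R.+-cong (R.*-cong p s) (R.*-cong q r))

  private
    module S = R.Solver
    open S

  +-assoc : ∀ x y z → (x + y) + z ≈ x + (y + z)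
  +-assoc x y z = eq (R.+-assoc (re x) (re y) (re z)) (R.+-assoc (im x) (im y) (im z))

  +-comm : ∀ x y → x + y ≈ y + x
  +-comm x y = eq (R.+-comm (re x) (re y)) (R.+-comm (im x) (im y))

  +-identityˡ : ∀ x → 0ᶜ + x ≈ x
  +-identityˡ x = eq (R.+-identityˡ (re x)) (R.+-identityˡ (im x))

  +-identityʳ : ∀ x → x + 0ᶜ ≈ x
  +-identityʳ x = eq (R.+-identityʳ (re x)) (R.+-identityʳ (im x))

  +-inverseˡ : ∀ x → - x + x ≈ 0ᶜ
  +-inverseˡ x = eq (R.+-inverseˡ (re x)) (R.+-inverseˡ (im x))

  +-inverseʳ : ∀ x → x + - x ≈ 0ᶜ
  +-inverseʳ x = eq (R.+-inverseʳ (re x)) (R.+-inverseʳ (im x))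

  *-assoc : ∀ x y z → (x * y) * z ≈ x * (y * z)
  *-assoc x y z = eq
    (solve 6 (λ a b c d e f → (a :* c :- b :* d) :* e :- (a :* d :+ b :* c) :* f
                           := a :* (c :* e :- d :* f) :- b :* (c :* f :+ d :* e))
      R.≈-refl (re x) (im x) (re y) (im y) (re z) (im z))
    (solve 6 (λ a b c d e f → (a :* c :- b :* d) :* f :+ (a :* d :+ b :* c) :* e
                           := a :* (c :* f :+ d :* e) :+ b :* (c :* e :- d :* f))
      R.≈-refl (re x) (im x) (re y) (im y) (re z) (im z))

  *-comm : ∀ x y → x * y ≈ y * x
  *-comm x y = eq
    (solve 4 (λ a b c d → a :* c :- b :* d := c :* a :- d :* b) R.≈-refl (re x) (im x) (re y) (im y))
    (solve 4 (λ a b c d → a :* d :+ b :* c := c :* b :+ d :* a) R.≈-refl (re x) (im x) (re y) (im y))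

  *-identityˡ : ∀ x → 1ᶜ * x ≈ x
  *-identityˡ x = eq
    (solve 2 (λ a b → con 1ℚ :* a :- con 0ℚ :* b := a) R.≈-refl (re x) (im x))
    (solve 2 (λ a b → con 1ℚ :* b :+ con 0ℚ :* a := b) R.≈-refl (re x) (im x))

  *-identityʳ : ∀ x → x * 1ᶜ ≈ x
  *-identityʳ x = ≈-trans (*-comm x 1ᶜ) (*-identityˡ x)

  distribˡ : ∀ x y z → x * (y + z) ≈ x * y + x * z
  distribˡ x y z = eq
    (solve 6 (λ a b c d e f → a :* (c :+ e) :- b :* (d :+ f) := (a :* c :- b :* d) :+ (a :* e :- b :* f))
      R.≈-refl (re x) (im x) (re y) (im y) (re z) (im z))
    (solve 6 (λ a b c d e f → a :* (d :+ f) :+ b :* (c :+ e) := (a :* d :+ b :* c) :+ (a :* f :+ b :* e))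
      R.≈-refl (re x) (im x) (re y) (im y) (re z) (im z))

  distribʳ : ∀ x y z → (y + z) * x ≈ y * x + z * x
  distribʳ x y z = ≈-trans (*-comm (y + z) x) (≈-trans (distribˡ x y z) (+-cong (*-comm x y) (*-comm x z)))

  commutativeRing : CommutativeRing 0ℓ 0ℓ
  commutativeRing = record
    { Carrier = ℂ ; _≈_ = _≈_ ; _+_ = _+_ ; _*_ = _*_ ; -_ = -_ ; 0# = 0ᶜ ; 1# = 1ᶜ
    ; isCommutativeRing = record
      { isRing = record
        { +-isAbelianGroup = record
          { isGroup = record
            { isMonoid = record
              { isSemigroup = record
                { isMagma = record
                  { isEquivalence = record { refl = ≈-refl ; sym = ≈-sym ; trans = ≈-trans }
                  ; ∙-cong = +-cong }
                ; assoc = +-assoc }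
              ; identity = +-identityˡ , +-identityʳ }
            ; inverse = +-inverseˡ , +-inverseʳ
            ; ⁻¹-cong = -‿cong }
          ; comm = +-comm }
        ; *-cong = *-cong
        ; *-assoc = *-assoc
        ; *-identity = *-identityˡ , *-identityʳ
        ; distrib = distribˡ , distribʳ }
      ; *-comm = *-comm } }

  almostRing : ACR.AlmostCommutativeRing 0ℓ 0ℓ
  almostRing = ACR.fromCommutativeRing commutativeRing

  ι-morphism : CommutativeRing.rawRing ℚ.+-*-commutativeRing ACR.-Raw-AlmostCommutative⟶ almostRing
  ι-morphism = record
    { ⟦_⟧ = ι₂
    ; +-homo = λ p q → eq (R.ι-+ p q) (R.≈-sym (R.+-identityˡ 0ᴿ))
    ; *-homo = λ p q → eq
        (R.≈-trans (R.ι-* p q) (solve 2 (λ a b → a :* b := a :* b :- con 0ℚ :* con 0ℚ) R.≈-refl (ι p) (ι q)))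
        (solve 2 (λ a b → con 0ℚ := a :* con 0ℚ :+ con 0ℚ :* b) R.≈-refl (ι p) (ι q))
    ; -‿homo = λ p → eq (R.pointwise (λ _ → refl)) (R.pointwise (λ _ → refl))
    ; 0-homo = ≈-refl ; 1-homo = ≈-refl }

  decide : ∀ p q → Maybe (ι₂ p ≈ ι₂ q)
  decide p q with p ℚ.≟ q
  ... | yes refl = just ≈-refl
  ... | no  _    = nothing

  module Solver = RingSolver (CommutativeRing.rawRing ℚ.+-*-commutativeRing) almostRing ι-morphism decide

  -- Inequalities between moduli are stated for their squares, avoiding roots.
  opaque

    ∣_∣² : ℂ → ℝ
    ∣ z ∣² = re z R.* re z R.+ im z R.* im z

    ∣∣²-cong : ∀ {z w} → z ≈ w → ∣ z ∣² R.≈ ∣ w ∣²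
    ∣∣²-cong (eq p q) = R.+-cong (R.*-cong p p) (R.*-cong q q)

    ∣∣²-nonNeg : ∀ z → 0ᴿ R.≤ ∣ z ∣²
    ∣∣²-nonNeg z = R.+-nonNeg (R.square-nonNegᴿ (re z)) (R.square-nonNegᴿ (im z))

    ∣∣²-* : ∀ z w → ∣ z * w ∣² R.≈ ∣ z ∣² R.* ∣ w ∣²
    ∣∣²-* z w = solve 4
      (λ a b c d → (a :* c :- b :* d) :* (a :* c :- b :* d) :+ (a :* d :+ b :* c) :* (a :* d :+ b :* c)
                := (a :* a :+ b :* b) :* (c :* c :+ d :* d))
      R.≈-refl (re z) (im z) (re w) (im w)

    ∣∣²-neg : ∀ z → ∣ - z ∣² R.≈ ∣ z ∣²
    ∣∣²-neg z = solve 2 (λ a b → (:- a) :* (:- a) :+ (:- b) :* (:- b) := a :* a :+ b :* b) R.≈-refl (re z) (im z)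

    ∣∣²-ι : ∀ q → ∣ ι₂ q ∣² R.≈ ι (q ℚ.* q)
    ∣∣²-ι q = R.≈-trans (solve 1 (λ a → a :* a :+ con 0ℚ :* con 0ℚ := a :* a) R.≈-refl (ι q)) (R.≈-sym (R.ι-* q q))

    ∣∣²-zero : ∀ {z} → ∣ z ∣² R.≤ 0ᴿ → z ≈ 0ᶜ
    ∣∣²-zero {z} h = eq (R.square-zero (R.≤-trans (left (re z) (im z)) h)) (R.square-zero (R.≤-trans (right (re z) (im z)) h))
      where
      left : ∀ x y → x R.* x R.≤ x R.* x R.+ y R.* y
      left x y = R.≤-trans (R.≤-reflexive (R.≈-sym (R.+-identityʳ _))) (R.+-mono-≤ R.≤-refl (R.square-nonNegᴿ y))
      right : ∀ x y → y R.* y R.≤ x R.* x R.+ y R.* y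
      right x y = R.≤-trans (R.≤-reflexive (R.≈-sym (R.+-identityˡ _))) (R.+-mono-≤ (R.square-nonNegᴿ x) R.≤-refl)

    -- |z + w|² ≤ (1 + s) |z|² + (1 + t) |w|² whenever s t = 1.
    ∣∣²-+ : ∀ {s t} → 0ℚ ℚ.< t → s ℚ.* t ≡ 1ℚ → ∀ z w →
            ∣ z + w ∣² R.≤ (1ᴿ R.+ ι s) R.* ∣ z ∣² R.+ (1ᴿ R.+ ι t) R.* ∣ w ∣²
    ∣∣²-+ {s} {t} 0<t st≡1 z w = R.0≤y-x⇒x≤y (R.≤-trans
        (R.*-nonNeg (R.ι-nonNeg (ℚ.<⇒≤ 0<t)) (∣∣²-nonNeg (ι₂ s * z - w)))
        (R.≤-reflexive (R.≈-trans (expand (ι s) (ι t) (re z) (im z) (re w) (im w)) (R.≈-trans (collapse _ _ _ st≈1)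
          (regroup (ι s) (ι t) (re z) (im z) (re w) (im w))))))
      where
      st≈1 : ι s R.* ι t R.≈ 1ᴿ
      st≈1 = R.≈-trans (R.≈-sym (R.ι-* s t)) (R.pointwise (λ _ → st≡1))
      expand : ∀ S T a b c d →
        T R.* ((S R.* a R.- 0ᴿ R.* b R.+ R.- c) R.* (S R.* a R.- 0ᴿ R.* b R.+ R.- c)
           R.+ (S R.* b R.+ 0ᴿ R.* a R.+ R.- d) R.* (S R.* b R.+ 0ᴿ R.* a R.+ R.- d))
        R.≈ (S R.* T) R.* (S R.* (a R.* a R.+ b R.* b) R.- (ι (1ℚ ℚ.+ 1ℚ)) R.* (a R.* c R.+ b R.* d)) R.+ T R.* (c R.* c R.+ d R.* d)
      expand = solve 6 (λ S T a b c d →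
        T :* ((S :* a :- con 0ℚ :* b :+ :- c) :* (S :* a :- con 0ℚ :* b :+ :- c)
           :+ (S :* b :+ con 0ℚ :* a :+ :- d) :* (S :* b :+ con 0ℚ :* a :+ :- d))
        := (S :* T) :* (S :* (a :* a :+ b :* b) :- (con (1ℚ ℚ.+ 1ℚ)) :* (a :* c :+ b :* d)) :+ T :* (c :* c :+ d :* d)) R.≈-refl
      collapse : ∀ p x y → p R.≈ 1ᴿ → p R.* x R.+ y R.≈ x R.+ y
      collapse p x y p≈1 = R.+-cong (R.≈-trans (R.*-cong p≈1 R.≈-refl) (R.*-identityˡ x)) R.≈-refl
      regroup : ∀ S T a b c d →
        (S R.* (a R.* a R.+ b R.* b) R.- (ι (1ℚ ℚ.+ 1ℚ)) R.* (a R.* c R.+ b R.* d)) R.+ T R.* (c R.* c R.+ d R.* d)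
        R.≈ ((1ᴿ R.+ S) R.* (a R.* a R.+ b R.* b) R.+ (1ᴿ R.+ T) R.* (c R.* c R.+ d R.* d))
            R.- ((a R.+ c) R.* (a R.+ c) R.+ (b R.+ d) R.* (b R.+ d))
      regroup = solve 6 (λ S T a b c d →
        (S :* (a :* a :+ b :* b) :- (con (1ℚ ℚ.+ 1ℚ)) :* (a :* c :+ b :* d)) :+ T :* (c :* c :+ d :* d)
        := ((con 1ℚ :+ S) :* (a :* a :+ b :* b) :+ (con 1ℚ :+ T) :* (c :* c :+ d :* d))
            :- ((a :+ c) :* (a :+ c) :+ (b :+ d) :* (b :+ d))) R.≈-refl

  2ᴿ : ℝ
  2ᴿ = ι (1ℚ ℚ.+ 1ℚ)

  ∣∣²-+₂ : ∀ z w → ∣ z + w ∣² R.≤ 2ᴿ R.* ∣ z ∣² R.+ 2ᴿ R.* ∣ w ∣²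
  ∣∣²-+₂ z w = R.≤-trans (∣∣²-+ {1ℚ} {1ℚ} Rational.0<1 refl z w)
    (R.≤-reflexive (solve 2 (λ x y → (con 1ℚ :+ con 1ℚ) :* x :+ (con 1ℚ :+ con 1ℚ) :* y
                                  := con (1ℚ ℚ.+ 1ℚ) :* x :+ con (1ℚ ℚ.+ 1ℚ) :* y) R.≈-refl ∣ z ∣² ∣ w ∣²))

open Rational using (0<1; +-pos; *-pos; split; half-pos; halves)
open Real using (ℝ; ι; 0ᴿ; 1ᴿ)
open Complex
open Exp (CommutativeRing.semiring Complex.commutativeRing) using (_^_; ^-homo-*)

Ball : ℂ → ℚ → Pred ℂ 0ℓ
Ball p δ z = ∣ z - p ∣² R.< ι (δ ℚ.* δ)

infix 4 _#_
-- Positive form of z ≠ p.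
_#_ : ℂ → ℂ → Set
z # p = 0ᴿ R.< ∣ z - p ∣²

Open : Pred ℂ 0ℓ → Set
Open D = ∀ z → z ∈ D → ∃ λ δ → 0ℚ ℚ.< δ × Ball z δ ⊆ D

-- Invariance under _≈_ is not required: differentiable functions have it
-- (the difference quotient estimate with w ≈ z forces f w ≈ f z).
Function : Pred ℂ 0ℓ → Set
Function D = ∀ z → z ∈ D → ℂ

infix 4 _HasDerivative_
-- |f(w) − f(z) − f′(z)(w − z)| ≤ ε|w − z| for all w in D near z.
record _HasDerivative_ {D : Pred ℂ 0ℓ} (f f′ : Function D) : Set where
  no-eta-equality; pattern
  constructor deriv
  field
    approx : ∀ z (r : z ∈ D) ε → 0ℚ ℚ.< ε → ∃ λ δ → 0ℚ ℚ.< δ ×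
             (∀ w (s : w ∈ D) → w ∈ Ball z δ →
              ∣ f w s - f z r - f′ z r * (w - z) ∣² R.≤ ι (ε ℚ.* ε) R.* ∣ w - z ∣²)
open _HasDerivative_ public

module Calculus where

  open R.≲-Reasoning

  err : ∀ {D} (f f′ : Function D) z (r : z ∈ D) w (s : w ∈ D) → ℂ
  err f f′ z r w s = f w s - f z r - f′ z r * (w - z)

  small : ∀ {ε b} → 0ℚ ℚ.< ε → 0ℚ ℚ.< b → ∃ λ η → 0ℚ ℚ.< η × η ℚ.≤ 1ℚ × η ℚ.* b ℚ.≤ ε
  small {ε} {b} 0<ε 0<b = let η , 0<η , ηb≡ε = split 0<ε 0<b in
    η ℚ.⊓ 1ℚ , pos η 0<η (ℚ.⊓-sel η 1ℚ) , ℚ.p⊓q≤q η 1ℚ ,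
    ℚ.≤-trans (ℚ.*-monoʳ-≤-nonNeg b {{nonNegative (ℚ.<⇒≤ 0<b)}} (ℚ.p⊓q≤p η 1ℚ)) (ℚ.≤-reflexive ηb≡ε)
    where
    pos : ∀ η → 0ℚ ℚ.< η → (η ℚ.⊓ 1ℚ ≡ η) ⊎ (η ℚ.⊓ 1ℚ ≡ 1ℚ) → 0ℚ ℚ.< η ℚ.⊓ 1ℚ
    pos η 0<η (inj₁ e) = ≡.subst (0ℚ ℚ.<_) (≡.sym e) 0<η
    pos η 0<η (inj₂ e) = ≡.subst (0ℚ ℚ.<_) (≡.sym e) 0<1

  min-pos : ∀ {p q} → 0ℚ ℚ.< p → 0ℚ ℚ.< q → 0ℚ ℚ.< p ℚ.⊓ q
  min-pos {p} {q} 0<p 0<q = go (ℚ.⊓-sel p q)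
    where
    go : (p ℚ.⊓ q ≡ p) ⊎ (p ℚ.⊓ q ≡ q) → 0ℚ ℚ.< p ℚ.⊓ q
    go (inj₁ e) = ≡.subst (0ℚ ℚ.<_) (≡.sym e) 0<p
    go (inj₂ e) = ≡.subst (0ℚ ℚ.<_) (≡.sym e) 0<q

  square-small : ∀ {η} → 0ℚ ℚ.< η → η ℚ.≤ 1ℚ → η ℚ.* η ℚ.≤ η
  square-small {η} 0<η η≤1 = ℚ.≤-trans (Rational.*-monoˡ (ℚ.<⇒≤ 0<η) η≤1) (ℚ.≤-reflexive (ℚ.*-identityʳ η))

  ball-mono : ∀ {p δ δ′} → 0ℚ ℚ.< δ → δ ℚ.≤ δ′ → Ball p δ ⊆ Ball p δ′
  ball-mono 0<δ δ≤δ′ z∈B = R.<-≤-trans z∈B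
    (R.ι-mono-≤ (Rational.*-mono (ℚ.<⇒≤ 0<δ) δ≤δ′ (ℚ.<⇒≤ 0<δ) δ≤δ′))

  ball-⊓ˡ : ∀ {p δ δ′} → 0ℚ ℚ.< δ → 0ℚ ℚ.< δ′ → Ball p (δ ℚ.⊓ δ′) ⊆ Ball p δ
  ball-⊓ˡ {p} {δ} {δ′} 0<δ 0<δ′ = ball-mono {p} {δ ℚ.⊓ δ′} {δ} (min-pos 0<δ 0<δ′) (ℚ.p⊓q≤p δ δ′)

  ball-⊓ʳ : ∀ {p δ δ′} → 0ℚ ℚ.< δ → 0ℚ ℚ.< δ′ → Ball p (δ ℚ.⊓ δ′) ⊆ Ball p δ′
  ball-⊓ʳ {p} {δ} {δ′} 0<δ 0<δ′ = ball-mono {p} {δ ℚ.⊓ δ′} {δ′} (min-pos 0<δ 0<δ′) (ℚ.p⊓q≤q δ δ′)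

  Approx : ∀ {D} (f f′ : Function D) z → z ∈ D → ℚ → Set
  Approx {D} f f′ z r ε = ∃ λ δ → 0ℚ ℚ.< δ × (∀ w (s : w ∈ D) → w ∈ Ball z δ →
    ∣ err f f′ z r w s ∣² R.≤ ι ε R.* ∣ w - z ∣²)

  to : ∀ {D} {f f′ : Function D} → f HasDerivative f′ → ∀ z (r : z ∈ D) ε → 0ℚ ℚ.< ε → Approx f f′ z r ε
  to f′≈ z r ε 0<ε =
    let η , 0<η , η≤1 , ηb≤ε = small 0<ε 0<1 ; δ , 0<δ , h = approx f′≈ z r η 0<η in
    δ , 0<δ , λ w s b → R.≤-trans (h w s b)
      (R.*-mono-≤ (R.ι-nonNeg (ℚ.<⇒≤ (*-pos 0<η 0<η)))
        (R.ι-mono-≤ (ℚ.≤-trans (square-small 0<η η≤1) (ℚ.≤-trans (ℚ.≤-reflexive (≡.sym (ℚ.*-identityʳ η))) ηb≤ε)))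
        (∣∣²-nonNeg (w - z)) R.≤-refl)

  from : ∀ {D} {f f′ : Function D} → (∀ z (r : z ∈ D) ε → 0ℚ ℚ.< ε → Approx f f′ z r ε) → f HasDerivative f′
  from h = deriv λ z r ε 0<ε → h z r (ε ℚ.* ε) (*-pos 0<ε 0<ε)

  exact : ∀ {D} {f f′ : Function D} → (∀ z r w s → err f f′ z r w s ≈ 0ᶜ) → f HasDerivative f′
  exact {f = f} {f′} h = deriv λ z r ε 0<ε → 1ℚ , 0<1 , λ w s _ → begin
    ∣ err f f′ z r w s ∣²              ≈⟨ ∣∣²-cong (h z r w s) ⟩
    ∣ 0ᶜ ∣²                            ≈⟨ ∣∣²-ι 0ℚ ⟩
    0ᴿ                                 ≲⟨ R.*-nonNeg (R.ι-nonNeg (ℚ.<⇒≤ (*-pos 0<ε 0<ε))) (∣∣²-nonNeg (w - z)) ⟩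
    ι (ε ℚ.* ε) R.* ∣ w - z ∣²         ∎

  deriv-const : ∀ {D} c → _HasDerivative_ {D} (λ _ _ → c) (λ _ _ → 0ᶜ)
  deriv-const c = exact λ z r w s →
    solve 3 (λ c z w → c :- c :- con 0ℚ :* (w :- z) := con 0ℚ) ≈-refl c z w
    where open Solver

  deriv-linear : ∀ {D} p → _HasDerivative_ {D} (λ z _ → z - p) (λ _ _ → 1ᶜ)
  deriv-linear p = exact λ z r w s →
    solve 3 (λ p z w → (w :- p) :- (z :- p) :- con 1ℚ :* (w :- z) := con 0ℚ) ≈-refl p z w
    where open Solver

  deriv-restrict : ∀ {D E} {f f′ : Function D} (E⊆D : E ⊆ D) → f HasDerivative f′ →
                   _HasDerivative_ {E} (λ z r → f z (E⊆D r)) (λ z r → f′ z (E⊆D r))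
  deriv-restrict E⊆D d = deriv λ z r ε 0<ε → let δ , 0<δ , h = approx d z (E⊆D r) ε 0<ε in
    δ , 0<δ , λ w s → h w (E⊆D s)

  4ℚ : ℚ
  4ℚ = (1ℚ ℚ.+ 1ℚ) ℚ.+ (1ℚ ℚ.+ 1ℚ)

  0<4 : 0ℚ ℚ.< 4ℚ
  0<4 = ℚ.positive⁻¹ 4ℚ

  0≤2 : 0ᴿ R.≤ 2ᴿ
  0≤2 = R.ι-nonNeg (ℚ.<⇒≤ (ℚ.positive⁻¹ (1ℚ ℚ.+ 1ℚ)))

  sum-bound : ∀ {a b} {x y} → ∣ a ∣² R.≤ x → ∣ b ∣² R.≤ y → ∣ a + b ∣² R.≤ 2ᴿ R.* x R.+ 2ᴿ R.* y
  sum-bound {a} {b} ha hb = R.≤-trans (∣∣²-+₂ a b) (R.+-mono-≤ (R.*-mono-≤ˡ 0≤2 ha) (R.*-mono-≤ˡ 0≤2 hb))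

  prod-bound : ∀ {a b} {x y} → ∣ a ∣² R.≤ x → ∣ b ∣² R.≤ y → ∣ a * b ∣² R.≤ x R.* y
  prod-bound {a} {b} ha hb = R.≤-trans (R.≤-reflexive (∣∣²-* a b))
    (R.*-mono-≤ (∣∣²-nonNeg a) ha (∣∣²-nonNeg b) hb)

  deriv-+ : ∀ {D} {f f′ g g′ : Function D} → f HasDerivative f′ → g HasDerivative g′ →
            _HasDerivative_ {D} (λ z r → f z r + g z r) (λ z r → f′ z r + g′ z r)
  deriv-+ {D} {f} {f′} {g} {g′} df dg = from go
    where
    lem : ∀ fw fz f′z gw gz g′z h → fw + gw - (fz + gz) - (f′z + g′z) * h ≈ (fw - fz - f′z * h) + (gw - gz - g′z * h)
    lem = solve 7 (λ fw fz f′z gw gz g′z h → fw :+ gw :- (fz :+ gz) :- (f′z :+ g′z) :* h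
                                           := (fw :- fz :- f′z :* h) :+ (gw :- gz :- g′z :* h)) ≈-refl
      where open Solver
    collect : ∀ e n → 2ᴿ R.* (e R.* n) R.+ 2ᴿ R.* (e R.* n) R.≈ (e R.* ι 4ℚ) R.* n
    collect = solve 2 (λ e n → con (1ℚ ℚ.+ 1ℚ) :* (e :* n) :+ con (1ℚ ℚ.+ 1ℚ) :* (e :* n) := (e :* con 4ℚ) :* n) R.≈-refl
      where open R.Solver
    go : ∀ z r ε → 0ℚ ℚ.< ε → Approx (λ z r → f z r + g z r) (λ z r → f′ z r + g′ z r) z r ε
    go z r ε 0<ε =
      let η , 0<η , η4≡ε = split 0<ε 0<4
          δ₁ , 0<δ₁ , h₁ = to df z r η 0<η
          δ₂ , 0<δ₂ , h₂ = to dg z r η 0<η in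
      δ₁ ℚ.⊓ δ₂ , min-pos 0<δ₁ 0<δ₂ , λ w s b → begin
        ∣ err (λ z r → f z r + g z r) (λ z r → f′ z r + g′ z r) z r w s ∣²
          ≈⟨ ∣∣²-cong (lem (f w s) (f z r) (f′ z r) (g w s) (g z r) (g′ z r) (w - z)) ⟩
        ∣ err f f′ z r w s + err g g′ z r w s ∣²
          ≲⟨ sum-bound (h₁ w s (ball-⊓ˡ {z} {δ₁} {δ₂} 0<δ₁ 0<δ₂ b)) (h₂ w s (ball-⊓ʳ {z} {δ₁} {δ₂} 0<δ₁ 0<δ₂ b)) ⟩
        2ᴿ R.* (ι η R.* ∣ w - z ∣²) R.+ 2ᴿ R.* (ι η R.* ∣ w - z ∣²)
          ≈⟨ collect (ι η) ∣ w - z ∣² ⟩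
        (ι η R.* ι 4ℚ) R.* ∣ w - z ∣²
          ≈⟨ R.*-cong (R.≈-trans (R.≈-sym (R.ι-* η 4ℚ)) (R.pointwise (λ _ → η4≡ε))) R.≈-refl ⟩
        ι ε R.* ∣ w - z ∣² ∎

  deriv-scale : ∀ {D} {f f′ : Function D} c → f HasDerivative f′ → _HasDerivative_ {D} (λ z r → c * f z r) (λ z r → c * f′ z r)
  deriv-scale {D} {f} {f′} c df = from go
    where
    lem : ∀ c fw fz f′z h → c * fw - c * fz - c * f′z * h ≈ c * (fw - fz - f′z * h)
    lem = solve 5 (λ c fw fz f′z h → c :* fw :- c :* fz :- c :* f′z :* h := c :* (fw :- fz :- f′z :* h)) ≈-refl
      where open Solver
    collect : ∀ m e n → m R.* (e R.* n) R.≈ (e R.* m) R.* n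
    collect = solve 3 (λ m e n → m :* (e :* n) := (e :* m) :* n) R.≈-refl
      where open R.Solver
    go : ∀ z r ε → 0ℚ ℚ.< ε → Approx (λ z r → c * f z r) (λ z r → c * f′ z r) z r ε
    go z r ε 0<ε =
      let m , 0<m , c≤m = R.bounded ∣ c ∣²
          η , 0<η , ηm≡ε = split 0<ε 0<m
          δ , 0<δ , h = to df z r η 0<η in
      δ , 0<δ , λ w s b → begin
        ∣ err (λ z r → c * f z r) (λ z r → c * f′ z r) z r w s ∣²
          ≈⟨ ∣∣²-cong (lem c (f w s) (f z r) (f′ z r) (w - z)) ⟩
        ∣ c * err f f′ z r w s ∣²
          ≲⟨ prod-bound c≤m (h w s b) ⟩
        ι m R.* (ι η R.* ∣ w - z ∣²)
          ≈⟨ collect (ι m) (ι η) ∣ w - z ∣² ⟩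
        (ι η R.* ι m) R.* ∣ w - z ∣²
          ≈⟨ R.*-cong (R.≈-trans (R.≈-sym (R.ι-* η m)) (R.pointwise (λ _ → ηm≡ε))) R.≈-refl ⟩
        ι ε R.* ∣ w - z ∣² ∎

  deriv-* : ∀ {D} {f f′ g g′ : Function D} → f HasDerivative f′ → g HasDerivative g′ →
            _HasDerivative_ {D} (λ z r → f z r * g z r) (λ z r → f′ z r * g z r + f z r * g′ z r)
  deriv-* {D} {f} {f′} {g} {g′} df dg = from go
    where
    lem : ∀ fw fz f′z gw gz g′z h → fw * gw - fz * gz - (f′z * gz + fz * g′z) * h
          ≈ (fw - fz - f′z * h) * gw + (fz * (gw - gz - g′z * h) + f′z * (h * (gw - gz)))
    lem = solve 7 (λ fw fz f′z gw gz g′z h → fw :* gw :- fz :* gz :- (f′z :* gz :+ fz :* g′z) :* h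
            := (fw :- fz :- f′z :* h) :* gw :+ (fz :* (gw :- gz :- g′z :* h) :+ f′z :* (h :* (gw :- gz)))) ≈-refl
      where open Solver
    increment : ∀ gw gz g′z h → gw - gz ≈ (gw - gz - g′z * h) + g′z * h
    increment = solve 4 (λ gw gz g′z h → gw :- gz := (gw :- gz :- g′z :* h) :+ g′z :* h) ≈-refl
      where open Solver
    recover : ∀ gw gz → gw ≈ gz + (gw - gz)
    recover = solve 2 (λ gw gz → gw := gz :+ (gw :- gz)) ≈-refl
      where open Solver
    go : ∀ z r ε → 0ℚ ℚ.< ε →
         Approx (λ z r → f z r * g z r) (λ z r → f′ z r * g z r + f z r * g′ z r) z r ε
    go z r ε 0<ε =
      let F , 0<F , f≤F = R.bounded ∣ f z r ∣²
          P , 0<P , f′≤P = R.bounded ∣ f′ z r ∣²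
          G , 0<G , g≤G = R.bounded ∣ g z r ∣²
          Q , 0<Q , g′≤Q = R.bounded ∣ g′ z r ∣²
          2ℚ = 1ℚ ℚ.+ 1ℚ
          0<2 = ℚ.positive⁻¹ 2ℚ
          K = 2ℚ ℚ.+ 2ℚ ℚ.* Q
          0<K = +-pos 0<2 (*-pos 0<2 0<Q)
          H = 2ℚ ℚ.* G ℚ.+ 2ℚ ℚ.* K
          0<H = +-pos (*-pos 0<2 0<G) (*-pos 0<2 0<K)
          B = 2ℚ ℚ.* H ℚ.+ 2ℚ ℚ.* (2ℚ ℚ.* F ℚ.+ 2ℚ ℚ.* (P ℚ.* K))
          0<B = +-pos (*-pos 0<2 0<H) (*-pos 0<2 (+-pos (*-pos 0<2 0<F) (*-pos 0<2 (*-pos 0<P 0<K))))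
          η , 0<η , η≤1 , ηB≤ε = small 0<ε 0<B
          δ₁ , 0<δ₁ , h₁ = to df z r η 0<η
          δ₂ , 0<δ₂ , h₂ = to dg z r η 0<η
          δ₁₂ = δ₁ ℚ.⊓ δ₂
          0<δ₁₂ = min-pos 0<δ₁ 0<δ₂
      in δ₁₂ ℚ.⊓ η , min-pos 0<δ₁₂ 0<η , λ w s b →
        let b₁₂ = ball-⊓ˡ {z} {δ₁₂} {η} 0<δ₁₂ 0<η b
            n = ∣ w - z ∣²
            0≤n = ∣∣²-nonNeg (w - z)
            n≤η : n R.≤ ι η
            n≤η = R.≤-trans (R.<⇒≤ (ball-⊓ʳ {z} {δ₁₂} {η} 0<δ₁₂ 0<η b)) (R.ι-mono-≤ (square-small 0<η η≤1))
            n≤1 : n R.≤ 1ᴿ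
            n≤1 = R.≤-trans n≤η (R.ι-mono-≤ η≤1)
            ηn≤n : ι η R.* n R.≤ n
            ηn≤n = R.≤-trans (R.*-mono-≤ (R.ι-nonNeg (ℚ.<⇒≤ 0<η)) (R.ι-mono-≤ η≤1) 0≤n R.≤-refl) (R.≤-reflexive (R.*-identityˡ n))
            e₁ : ∣ err f f′ z r w s ∣² R.≤ ι η R.* n
            e₁ = h₁ w s (ball-⊓ˡ {z} {δ₁} {δ₂} 0<δ₁ 0<δ₂ b₁₂)
            e₂ : ∣ err g g′ z r w s ∣² R.≤ ι η R.* n
            e₂ = h₂ w s (ball-⊓ʳ {z} {δ₁} {δ₂} 0<δ₁ 0<δ₂ b₁₂)
            Δ : ∣ g w s - g z r ∣² R.≤ ι K R.* n
            Δ = R.≤-trans (R.≤-reflexive (∣∣²-cong (increment (g w s) (g z r) (g′ z r) (w - z))))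
                  (R.≤-trans (sum-bound (R.≤-trans e₂ ηn≤n) (prod-bound {g′ z r} {w - z} g′≤Q R.≤-refl))
                    (R.≤-reflexive (shapeK Q n)))
            Δ₁ : ∣ g w s - g z r ∣² R.≤ ι K
            Δ₁ = R.≤-trans Δ (R.≤-trans (R.*-mono-≤ˡ (R.ι-nonNeg (ℚ.<⇒≤ 0<K)) n≤1) (R.≤-reflexive (R.*-identityʳ (ι K))))
            gw : ∣ g w s ∣² R.≤ ι H
            gw = R.≤-trans (R.≤-reflexive (∣∣²-cong (recover (g w s) (g z r))))
                   (R.≤-trans (sum-bound g≤G Δ₁) (R.≤-reflexive (R.pointwise (λ _ → refl))))
            Δη : ι K R.* n R.≤ ι K R.* ι η
            Δη = R.*-mono-≤ˡ (R.ι-nonNeg (ℚ.<⇒≤ 0<K)) n≤η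
        in begin
        ∣ err (λ z r → f z r * g z r) (λ z r → f′ z r * g z r + f z r * g′ z r) z r w s ∣²
          ≈⟨ ∣∣²-cong (lem (f w s) (f z r) (f′ z r) (g w s) (g z r) (g′ z r) (w - z)) ⟩
        ∣ err f f′ z r w s * g w s + (f z r * err g g′ z r w s + f′ z r * ((w - z) * (g w s - g z r))) ∣²
          ≲⟨ sum-bound (prod-bound e₁ gw)
               (sum-bound (prod-bound f≤F e₂) (prod-bound f′≤P (prod-bound {w - z} R.≤-refl (R.≤-trans Δ Δη)))) ⟩
        2ᴿ R.* (ι η R.* n R.* ι H) R.+ 2ᴿ R.* (2ᴿ R.* (ι F R.* (ι η R.* n)) R.+ 2ᴿ R.* (ι P R.* (n R.* (ι K R.* ι η))))
          ≈⟨ shapeB (ι η) n (ι H) (ι F) (ι P) (ι K) ⟩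
        ι η R.* (2ᴿ R.* ι H R.+ 2ᴿ R.* (2ᴿ R.* ι F R.+ 2ᴿ R.* (ι P R.* ι K))) R.* n
          ≈⟨ R.*-cong (R.pointwise (λ _ → refl)) R.≈-refl ⟩
        ι (η ℚ.* B) R.* n
          ≲⟨ R.*-mono-≤ (R.ι-nonNeg (ℚ.<⇒≤ (*-pos 0<η 0<B))) (R.ι-mono-≤ ηB≤ε) 0≤n R.≤-refl ⟩
        ι ε R.* n ∎
      where
      shapeK : ∀ Q n → 2ᴿ R.* n R.+ 2ᴿ R.* (ι Q R.* n) R.≈ ι ((1ℚ ℚ.+ 1ℚ) ℚ.+ (1ℚ ℚ.+ 1ℚ) ℚ.* Q) R.* n
      shapeK Q n = R.≈-trans
        (solve 3 (λ t q n → t :* n :+ t :* (q :* n) := (t :+ t :* q) :* n) R.≈-refl 2ᴿ (ι Q) n)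
        (R.*-cong (R.pointwise (λ _ → refl)) R.≈-refl)
        where open R.Solver
      shapeB : ∀ e n h f p k →
        2ᴿ R.* (e R.* n R.* h) R.+ 2ᴿ R.* (2ᴿ R.* (f R.* (e R.* n)) R.+ 2ᴿ R.* (p R.* (n R.* (k R.* e))))
        R.≈ e R.* (2ᴿ R.* h R.+ 2ᴿ R.* (2ᴿ R.* f R.+ 2ᴿ R.* (p R.* k))) R.* n
      shapeB = solve 7 (λ t e n h f p k →
        t :* (e :* n :* h) :+ t :* (t :* (f :* (e :* n)) :+ t :* (p :* (n :* (k :* e))))
        := e :* (t :* h :+ t :* (t :* f :+ t :* (p :* k))) :* n) R.≈-refl 2ᴿ
        where open R.Solver

  deriv-cong : ∀ {D} {f f′ g′ : Function D} → (∀ z r → f′ z r ≈ g′ z r) → f HasDerivative f′ → f HasDerivative g′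
  deriv-cong f′≈g′ df = deriv λ z r ε 0<ε → let δ , 0<δ , h = approx df z r ε 0<ε in
    δ , 0<δ , λ w s b → R.≤-trans
      (R.≤-reflexive (∣∣²-cong (+-cong ≈-refl (-‿cong (*-cong (≈-sym (f′≈g′ z r)) ≈-refl)))))
      (h w s b)

  -- Test the two approximations along w = z + δ/2.
  unique : ∀ {D} {f f′ g g′ : Function D} → Open D → f HasDerivative f′ → g HasDerivative g′ →
           (∀ z r → f z r ≈ g z r) → ∀ z r → f′ z r ≈ g′ z r
  unique {D} {f} {f′} {g} {g′} openD df dg f≈g z r =
    ≈-trans (recover (f′ z r) (g′ z r)) (≈-trans (+-cong ≈-refl (∣∣²-zero (R.≤-limit go))) (+-identityʳ (g′ z r)))
    where
    recover : ∀ a b → a ≈ b + (a - b)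
    recover = solve 2 (λ a b → a := b :+ (a :- b)) ≈-refl
      where open Solver
    go : ∀ ε → 0ℚ ℚ.< ε → ∣ f′ z r - g′ z r ∣² R.≤ 0ᴿ R.+ ι ε
    go ε 0<ε =
      let η , 0<η , η4≡ε = split 0<ε 0<4
          δ₁ , 0<δ₁ , h₁ = to df z r η 0<η
          δ₂ , 0<δ₂ , h₂ = to dg z r η 0<η
          δ₃ , 0<δ₃ , ball⊆D = openD z r
          δ₁₂ = δ₁ ℚ.⊓ δ₂
          0<δ₁₂ = min-pos 0<δ₁ 0<δ₂
          δ = δ₁₂ ℚ.⊓ δ₃
          0<δ = min-pos 0<δ₁₂ 0<δ₃
          q = ½ ℚ.* δ
          0<q = half-pos 0<δ
          qq = q ℚ.* q
          0<qq = *-pos 0<q 0<q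
          q<δ : q ℚ.< δ
          q<δ = ≡.subst₂ ℚ._<_ (ℚ.+-identityʳ q) (halves δ) (ℚ.+-monoʳ-< q 0<q)
          i , 0<i , i*qq≡1 = split 0<1 0<qq
          w = z + ι₂ q
          w-z≈q : w - z ≈ ι₂ q
          w-z≈q = shift z (ι₂ q)
          n≈ : ∣ w - z ∣² R.≈ ι qq
          n≈ = R.≈-trans (∣∣²-cong w-z≈q) (∣∣²-ι q)
          b : w ∈ Ball z δ
          b = R.≤-<-trans (R.≤-reflexive n≈) (R.ι-mono-< (ℚ.<-trans
                (ℚ.*-monoʳ-<-pos q {{positive 0<q}} q<δ) (ℚ.*-monoˡ-<-pos δ {{positive 0<δ}} q<δ)))
          b₁₂ = ball-⊓ˡ {z} {δ₁₂} {δ₃} 0<δ₁₂ 0<δ₃ b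
          s = ball⊆D (ball-⊓ʳ {z} {δ₁₂} {δ₃} 0<δ₁₂ 0<δ₃ b)
          d = f′ z r - g′ z r
          e₁ = h₁ w s (ball-⊓ˡ {z} {δ₁} {δ₂} 0<δ₁ 0<δ₂ b₁₂)
          e₂ = h₂ w s (ball-⊓ʳ {z} {δ₁} {δ₂} 0<δ₁ 0<δ₂ b₁₂)
          dn≤ : ∣ d ∣² R.* ι qq R.≤ (ι η R.* ι 4ℚ) R.* ι qq
          dn≤ = begin
            ∣ d ∣² R.* ι qq                ≈⟨ R.*-cong R.≈-refl (R.≈-sym n≈) ⟩
            ∣ d ∣² R.* ∣ w - z ∣²          ≈⟨ R.≈-sym (∣∣²-* d (w - z)) ⟩
            ∣ d * (w - z) ∣²
              ≈⟨ ∣∣²-cong (≈-trans (difference (f w s) (f z r) (f′ z r) (g′ z r) (w - z))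
                   (+-cong (-‿cong (+-cong (+-cong ≈-refl (-‿cong ≈-refl)) ≈-refl))
                           (+-cong (+-cong (f≈g w s) (-‿cong (f≈g z r))) ≈-refl))) ⟩
            ∣ - err f f′ z r w s + err g g′ z r w s ∣²
              ≲⟨ sum-bound (R.≤-trans (R.≤-reflexive (∣∣²-neg (err f f′ z r w s))) e₁) e₂ ⟩
            2ᴿ R.* (ι η R.* ∣ w - z ∣²) R.+ 2ᴿ R.* (ι η R.* ∣ w - z ∣²)
              ≈⟨ collect (ι η) ∣ w - z ∣² ⟩
            (ι η R.* ι 4ℚ) R.* ∣ w - z ∣²  ≈⟨ R.*-cong R.≈-refl n≈ ⟩
            (ι η R.* ι 4ℚ) R.* ι qq        ∎
          unit : ι qq R.* ι i R.≈ 1ᴿ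
          unit = R.≈-trans (R.≈-sym (R.ι-* qq i)) (R.pointwise (λ _ → ≡.trans (ℚ.*-comm qq i) i*qq≡1))
      in begin
        ∣ d ∣²                                     ≈⟨ cancel ∣ d ∣² (ι qq) (ι i) unit ⟩
        ι i R.* (∣ d ∣² R.* ι qq)                  ≲⟨ R.*-mono-≤ˡ (R.ι-nonNeg (ℚ.<⇒≤ 0<i)) dn≤ ⟩
        ι i R.* ((ι η R.* ι 4ℚ) R.* ι qq)          ≈⟨ R.≈-sym (cancel (ι η R.* ι 4ℚ) (ι qq) (ι i) unit) ⟩
        ι η R.* ι 4ℚ                               ≈⟨ R.≈-trans (R.≈-sym (R.ι-* η 4ℚ)) (R.pointwise (λ _ → η4≡ε)) ⟩
        ι ε                                        ≈⟨ R.≈-sym (R.+-identityˡ (ι ε)) ⟩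
        0ᴿ R.+ ι ε                                 ∎
      where
      shift : ∀ z q → z + q - z ≈ q
      shift = solve 2 (λ z q → z :+ q :- z := q) ≈-refl
        where open Solver
      difference : ∀ fw fz a b h → (a - b) * h ≈ - (fw - fz - a * h) + (fw - fz - b * h)
      difference = solve 5 (λ fw fz a b h → (a :- b) :* h := :- (fw :- fz :- a :* h) :+ (fw :- fz :- b :* h)) ≈-refl
        where open Solver
      collect : ∀ e n → 2ᴿ R.* (e R.* n) R.+ 2ᴿ R.* (e R.* n) R.≈ (e R.* ι 4ℚ) R.* n
      collect = solve 2 (λ e n → con (1ℚ ℚ.+ 1ℚ) :* (e :* n) :+ con (1ℚ ℚ.+ 1ℚ) :* (e :* n) := (e :* con 4ℚ) :* n) R.≈-refl
        where open R.Solver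
      cancel : ∀ x q i → q R.* i R.≈ 1ᴿ → x R.≈ i R.* (x R.* q)
      cancel x q i qi≈1 = R.≈-trans (R.≈-sym (R.*-identityʳ x)) (R.≈-trans (R.*-cong R.≈-refl (R.≈-sym qi≈1))
        (solve 3 (λ x q i → x :* (q :* i) := i :* (x :* q)) R.≈-refl x q i))
        where open R.Solver

  open-∩ : ∀ {D E} → Open D → Open E → Open (D ∩ E)
  open-∩ oD oE z (d , e) =
    let δ , 0<δ , h = oD z d ; δ′ , 0<δ′ , h′ = oE z e in
    δ ℚ.⊓ δ′ , min-pos 0<δ 0<δ′ , λ b → h (ball-⊓ˡ {z} {δ} {δ′} 0<δ 0<δ′ b) , h′ (ball-⊓ʳ {z} {δ} {δ′} 0<δ 0<δ′ b)

  decompose : ∀ w z p → w - p ≈ (z - p) + (w - z)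
  decompose = solve 3 (λ w z p → w :- p := (z :- p) :+ (w :- z)) ≈-refl
    where open Solver

  open-ball : ∀ p {δ} → 0ℚ ℚ.< δ → Open (Ball p δ)
  open-ball p {δ} 0<δ z z∈B =
    let D = δ ℚ.* δ
        g , 0<g , h = R.<-gap z∈B
        g₂ = ½ ℚ.* g ; 0<g₂ = half-pos 0<g
        g₄ = ½ ℚ.* g₂ ; 0<g₄ = half-pos 0<g₂
        s , 0<s , sD≡g₂ = split 0<g₂ (*-pos 0<δ 0<δ)
        t , 0<t , ts≡1 = split 0<1 0<s
        ρ , 0<ρ , ρ≤1 , ρt≤ = small 0<g₄ (+-pos 0<1 0<t)
    in ρ , 0<ρ , λ {w} w∈ → R.gap-< 0<g₄ (begin
      ∣ w - p ∣² R.+ ι g₄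
        ≲⟨ R.+-mono-≤ (R.≤-trans (R.≤-reflexive (∣∣²-cong (decompose w z p)))
             (∣∣²-+ {s} {t} 0<t (≡.trans (ℚ.*-comm s t) ts≡1) (z - p) (w - z))) R.≤-refl ⟩
      (1ᴿ R.+ ι s) R.* ∣ z - p ∣² R.+ (1ᴿ R.+ ι t) R.* ∣ w - z ∣² R.+ ι g₄
        ≈⟨ spread (ι s) ∣ z - p ∣² ((1ᴿ R.+ ι t) R.* ∣ w - z ∣²) (ι g₄) ⟩
      ∣ z - p ∣² R.+ (ι s R.* ∣ z - p ∣² R.+ ((1ᴿ R.+ ι t) R.* ∣ w - z ∣² R.+ ι g₄))
        ≲⟨ R.+-mono-≤ R.≤-refl (R.+-mono-≤
             (R.≤-trans (R.*-mono-≤ˡ (R.ι-nonNeg (ℚ.<⇒≤ 0<s)) (R.<⇒≤ z∈B)) (R.≤-reflexive (R.pointwise (λ _ → sD≡g₂))))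
             (R.+-mono-≤ (R.≤-trans (R.*-mono-≤ˡ (R.+-nonNeg (R.ι-nonNeg (ℚ.<⇒≤ 0<1)) (R.ι-nonNeg (ℚ.<⇒≤ 0<t)))
                             (R.≤-trans (R.<⇒≤ w∈) (R.ι-mono-≤ (square-small 0<ρ ρ≤1))))
                           (R.≤-trans (R.≤-reflexive (R.≈-trans (R.*-comm _ (ι ρ)) (R.pointwise (λ _ → refl)))) (R.ι-mono-≤ ρt≤)))
                         R.≤-refl)) ⟩
      ∣ z - p ∣² R.+ (ι g₂ R.+ (ι g₄ R.+ ι g₄))
        ≈⟨ R.+-cong R.≈-refl (R.pointwise (λ _ → ≡.trans (≡.cong (g₂ ℚ.+_) (halves g₂)) (halves g))) ⟩
      ∣ z - p ∣² R.+ ι g  ≲⟨ h ⟩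
      ι D                 ∎)
    where
    spread : ∀ s n m g → (1ᴿ R.+ s) R.* n R.+ m R.+ g R.≈ n R.+ (s R.* n R.+ (m R.+ g))
    spread = solve 4 (λ s n m g → (con 1ℚ :+ s) :* n :+ m :+ g := n :+ (s :* n :+ (m :+ g))) R.≈-refl
      where open R.Solver

  open-# : ∀ p → Open (_# p)
  open-# p z z#p =
    let g , 0<g , h = R.<-gap z#p
        η , 0<η , η4≡g = split 0<g 0<4
        ρ , 0<ρ , ρ≤1 , ρ1≤η = small 0<η 0<1
        ρρ≤η = ℚ.≤-trans (square-small 0<ρ ρ≤1) (ℚ.≤-trans (ℚ.≤-reflexive (≡.sym (ℚ.*-identityʳ ρ))) ρ1≤η)
    in ρ , 0<ρ , λ {w} w∈ → R.gap-< 0<η (begin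
      0ᴿ R.+ ι η
        ≈⟨ shape₁ (ι η) ⟩
      ι ½ R.* (0ᴿ R.+ ι η R.* ι 4ℚ R.- 2ᴿ R.* ι η)
        ≲⟨ R.*-mono-≤ˡ (R.ι-nonNeg (ℚ.<⇒≤ Rational.0<½)) (R.+-mono-≤ (begin
             0ᴿ R.+ ι η R.* ι 4ℚ                              ≈⟨ R.+-cong R.≈-refl (R.pointwise (λ _ → η4≡g)) ⟩
             0ᴿ R.+ ι g                                       ≲⟨ h ⟩
             ∣ z - p ∣²                                       ≈⟨ ∣∣²-cong (decompose′ z w p) ⟩
             ∣ (w - p) + - (w - z) ∣²                         ≲⟨ sum-bound R.≤-refl (R.≤-trans (R.≤-reflexive (∣∣²-neg (w - z)))
                                                                   (R.≤-trans (R.<⇒≤ w∈) (R.ι-mono-≤ ρρ≤η))) ⟩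
             2ᴿ R.* ∣ w - p ∣² R.+ 2ᴿ R.* ι η                 ∎) R.≤-refl) ⟩
      ι ½ R.* (2ᴿ R.* ∣ w - p ∣² R.+ 2ᴿ R.* ι η R.- 2ᴿ R.* ι η)
        ≈⟨ shape₂ ∣ w - p ∣² (ι η) ⟩
      ∣ w - p ∣²   ∎)
    where
    decompose′ : ∀ z w p → z - p ≈ (w - p) + - (w - z)
    decompose′ = solve 3 (λ z w p → z :- p := (w :- p) :+ :- (w :- z)) ≈-refl
      where open Solver
    shape₁ : ∀ e → 0ᴿ R.+ e R.≈ ι ½ R.* (0ᴿ R.+ e R.* ι 4ℚ R.- 2ᴿ R.* e)
    shape₁ = solve 1 (λ e → con 0ℚ :+ e := con ½ :* (con 0ℚ :+ e :* con 4ℚ :- con (1ℚ ℚ.+ 1ℚ) :* e)) R.≈-refl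
      where open R.Solver
    shape₂ : ∀ n e → ι ½ R.* (2ᴿ R.* n R.+ 2ᴿ R.* e R.- 2ᴿ R.* e) R.≈ n
    shape₂ = solve 2 (λ n e → con ½ :* (con (1ℚ ℚ.+ 1ℚ) :* n :+ con (1ℚ ℚ.+ 1ℚ) :* e :- con (1ℚ ℚ.+ 1ℚ) :* e) := n) R.≈-refl
      where open R.Solver

open Calculus

-- Complex differentiable functions, carried with all their derivatives as data:
-- by Goursat's theorem these exist for every complex differentiable function on
-- an open set, and having them makes d/dz an operator on such functions.
-- jet k is the k-th derivative.
record Holomorphic (D : Pred ℂ 0ℓ) : Set where
  no-eta-equality
  field
    jet       : ℕ → Function D
    jet-deriv : ∀ k → jet k HasDerivative jet (suc k)

  value : Function D
  value = jet 0
open Holomorphic public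

module Hol where

  const : ∀ {D} → ℂ → Holomorphic D
  const c .jet zero    _ _ = c
  const c .jet (suc _) _ _ = 0ᶜ
  const c .jet-deriv zero    = deriv-const c
  const c .jet-deriv (suc _) = deriv-const 0ᶜ

  linear : ∀ {D} → ℂ → Holomorphic D
  linear p .jet zero          z _ = z - p
  linear p .jet (suc zero)    _ _ = 1ᶜ
  linear p .jet (suc (suc _)) _ _ = 0ᶜ
  linear p .jet-deriv zero          = deriv-linear p
  linear p .jet-deriv (suc zero)    = deriv-const 1ᶜ
  linear p .jet-deriv (suc (suc _)) = deriv-const 0ᶜ

  ∂ : ∀ {D} → Holomorphic D → Holomorphic D
  ∂ f .jet k       = jet f (suc k)
  ∂ f .jet-deriv k = jet-deriv f (suc k)

  restrict : ∀ {D E} → E ⊆ D → Holomorphic D → Holomorphic E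
  restrict E⊆D f .jet k z r     = jet f k z (E⊆D r)
  restrict E⊆D f .jet-deriv k   = deriv-restrict E⊆D (jet-deriv f k)

  infixl 6 _+ʰ_
  infixl 7 _*ʰ_ _·ʰ_
  _+ʰ_ : ∀ {D} → Holomorphic D → Holomorphic D → Holomorphic D
  (f +ʰ g) .jet k z r   = jet f k z r + jet g k z r
  (f +ʰ g) .jet-deriv k = deriv-+ (jet-deriv f k) (jet-deriv g k)

  _·ʰ_ : ∀ {D} → ℂ → Holomorphic D → Holomorphic D
  (c ·ʰ f) .jet k z r   = c * jet f k z r
  (c ·ʰ f) .jet-deriv k = deriv-scale c (jet-deriv f k)

  -- The k-th derivative of a product, by repeatedly applying the product rule.
  leibniz : ∀ {D} → ℕ → (f g : ℕ → Function D) → Function D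
  leibniz zero    f g z r = f 0 z r * g 0 z r
  leibniz (suc k) f g z r = leibniz k (f ∘ suc) g z r + leibniz k f (g ∘ suc) z r

  leibniz-deriv : ∀ {D} k {f g : ℕ → Function D} → (∀ k → f k HasDerivative f (suc k)) →
                  (∀ k → g k HasDerivative g (suc k)) → leibniz k f g HasDerivative leibniz (suc k) f g
  leibniz-deriv zero    df dg = deriv-* (df 0) (dg 0)
  leibniz-deriv (suc k) df dg = deriv-+ (leibniz-deriv k (df ∘ suc) dg) (leibniz-deriv k df (dg ∘ suc))

  _*ʰ_ : ∀ {D} → Holomorphic D → Holomorphic D → Holomorphic D
  (f *ʰ g) .jet k       = leibniz k (jet f) (jet g)
  (f *ʰ g) .jet-deriv k = leibniz-deriv k (jet-deriv f) (jet-deriv g)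

  power : ∀ {D} → ℂ → ℕ → Holomorphic D
  power p zero    = const 1ᶜ
  power p (suc m) = linear p *ʰ power p m

  power-value : ∀ {D} p m z (r : z ∈ D) → value (power {D} p m) z r ≡ (z - p) ^ m
  power-value p zero    z r = refl
  power-value p (suc m) z r = ≡.cong ((z - p) *_) (power-value p m z r)

  fromℕ : ℕ → ℂ
  fromℕ zero    = 0ᶜ
  fromℕ (suc m) = 1ᶜ + fromℕ m

  -- (z - p) · d/dz (z - p)^m = m (z - p)^m
  power-deriv : ∀ {D} p m z (r : z ∈ D) →
                (z - p) * jet (power {D} p m) 1 z r ≈ fromℕ m * (z - p) ^ m
  power-deriv p zero z r = solve 1 (λ a → a :* con 0ℚ := con 0ℚ :* con 1ℚ) ≈-refl (z - p)
    where open Solver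
  power-deriv {D} p (suc m) z r = ≈-trans
    (lem₁ (z - p) (value (power {D} p m) z r) (jet (power {D} p m) 1 z r))
    (≈-trans (+-cong (≡⇒≈ (≡.cong ((z - p) *_) (power-value {D} p m z r))) (*-cong ≈-refl (power-deriv p m z r)))
      (lem₂ (z - p) ((z - p) ^ m) (fromℕ m)))
    where
    open Solver
    ≡⇒≈ : ∀ {x y} → x ≡ y → x ≈ y
    ≡⇒≈ refl = ≈-refl
    lem₁ : ∀ a v d → a * (1ᶜ * v + a * d) ≈ a * v + a * (a * d)
    lem₁ = solve 3 (λ a v d → a :* (con 1ℚ :* v :+ a :* d) := a :* v :+ a :* (a :* d)) ≈-refl
    lem₂ : ∀ a v n → a * v + a * (n * v) ≈ (1ᶜ + n) * (a * v)
    lem₂ = solve 3 (λ a v n → a :* v :+ a :* (n :* v) := (con 1ℚ :+ n) :* (a :* v)) ≈-refl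

record OpenSet : Set₁ where
  field
    set    : Pred ℂ 0ℓ
    isOpen : Open set
open OpenSet public

-- Near p the function is holomorphic off p, and (z - p)^order · f extends
-- holomorphically over p.
record AtMostPole {D : Pred ℂ 0ℓ} (f : Holomorphic D) (p : ℂ) : Set where
  no-eta-equality
  field
    radius     : ℚ
    radius-pos : 0ℚ ℚ.< radius
    punctured  : ∀ {z} → z ∈ Ball p radius → z # p → z ∈ D
    order      : ℕ
    extension  : Holomorphic (Ball p radius)
    extends    : ∀ z (b : z ∈ Ball p radius) → z # p → (r : z ∈ D) →
                 (z - p) ^ order * value f z r ≈ value extension z b
open AtMostPole public

-- By `polar`, the points of D outside `regular` are isolated: they are poles or
-- removable singularities.  As usual two functions are identified (_≋_) when
-- they agree at every point where both are regular.
record Meromorphic (D : OpenSet) : Set₁ where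
  no-eta-equality
  field
    regular      : Pred ℂ 0ℓ
    regular-open : Open regular
    regular⊆     : regular ⊆ set D
    holomorphic  : Holomorphic regular
    polar        : ∀ p → p ∈ set D → AtMostPole holomorphic p
open Meromorphic public

infix 4 _≋_
_≋_ : ∀ {D} → Meromorphic D → Meromorphic D → Set
f ≋ g = ∀ z (r : z ∈ regular f) (s : z ∈ regular g) → value (holomorphic f) z r ≈ value (holomorphic g) z s

module Polar where

  open Hol

  zero-polar : ∀ {D p} → Open D → p ∈ D → AtMostPole {D} (const 0ᶜ) p
  zero-polar {D} {p} oD p∈D = let δ , 0<δ , h = oD p p∈D in record
    { radius = δ ; radius-pos = 0<δ ; punctured = λ b _ → h b
    ; order = 0 ; extension = const 0ᶜ ; extends = λ _ _ _ _ → *-identityˡ 0ᶜ }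

  restrict-polar : ∀ {D E p} {f : Holomorphic D} → Open E → p ∈ E → AtMostPole f p →
                   AtMostPole {D ∩ E} (restrict proj₁ f) p
  restrict-polar {p = p} oE p∈E P = let δ , 0<δ , h = oE p p∈E in record
    { radius = radius P ℚ.⊓ δ ; radius-pos = min-pos (radius-pos P) 0<δ
    ; punctured = λ b z#p → punctured P (ball-⊓ˡ {p} {radius P} {δ} (radius-pos P) 0<δ b) z#p
                          , h (ball-⊓ʳ {p} {radius P} {δ} (radius-pos P) 0<δ b)
    ; order = order P
    ; extension = restrict (ball-⊓ˡ {p} {radius P} {δ} (radius-pos P) 0<δ) (extension P)
    ; extends = λ z b z#p r → extends P z (ball-⊓ˡ {p} {radius P} {δ} (radius-pos P) 0<δ b) z#p (proj₁ r) }

  module _ {D E : Pred ℂ 0ℓ} {f : Holomorphic D} {g : Holomorphic E} {p : ℂ}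
           (P : AtMostPole f p) (Q : AtMostPole g p) where

    private
      ρ = radius P ℚ.⊓ radius Q
      left : Ball p ρ ⊆ Ball p (radius P)
      left = ball-⊓ˡ {p} {radius P} {radius Q} (radius-pos P) (radius-pos Q)
      right : Ball p ρ ⊆ Ball p (radius Q)
      right = ball-⊓ʳ {p} {radius P} {radius Q} (radius-pos P) (radius-pos Q)
      m = order P
      n = order Q

    +-polar : AtMostPole {D ∩ E} (restrict proj₁ f +ʰ restrict proj₂ g) p
    +-polar = record
      { radius = ρ ; radius-pos = min-pos (radius-pos P) (radius-pos Q)
      ; punctured = λ b z#p → punctured P (left b) z#p , punctured Q (right b) z#p
      ; order = m ℕ.+ n
      ; extension = power p n *ʰ restrict left (extension P) +ʰ power p m *ʰ restrict right (extension Q)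
      ; extends = λ z b z#p (r , s) → begin
          (z - p) ^ (m ℕ.+ n) * (value f z r + value g z s)
            ≈⟨ *-cong (^-homo-* (z - p) m n) ≈-refl ⟩
          ((z - p) ^ m * (z - p) ^ n) * (value f z r + value g z s)
            ≈⟨ regroup ((z - p) ^ m) ((z - p) ^ n) (value f z r) (value g z s) ⟩
          (z - p) ^ n * ((z - p) ^ m * value f z r) + (z - p) ^ m * ((z - p) ^ n * value g z s)
            ≈⟨ +-cong (*-cong (≡⇒≈ (≡.sym (power-value p n z b))) (extends P z (left b) z#p r))
                      (*-cong (≡⇒≈ (≡.sym (power-value p m z b))) (extends Q z (right b) z#p s)) ⟩
          value (power p n) z b * value (extension P) z (left b) + value (power p m) z b * value (extension Q) z (right b)
            ∎ }
      where
      open import Relation.Binary.Reasoning.Setoid (CommutativeRing.setoid commutativeRing)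
      open CommutativeRing commutativeRing using () renaming (reflexive to ≡⇒≈)
      regroup : ∀ a b x y → (a * b) * (x + y) ≈ b * (a * x) + a * (b * y)
      regroup = solve 4 (λ a b x y → (a :* b) :* (x :+ y) := b :* (a :* x) :+ a :* (b :* y)) ≈-refl
        where open Solver

    *-polar : AtMostPole {D ∩ E} (restrict proj₁ f *ʰ restrict proj₂ g) p
    *-polar = record
      { radius = ρ ; radius-pos = min-pos (radius-pos P) (radius-pos Q)
      ; punctured = λ b z#p → punctured P (left b) z#p , punctured Q (right b) z#p
      ; order = m ℕ.+ n
      ; extension = restrict left (extension P) *ʰ restrict right (extension Q)
      ; extends = λ z b z#p (r , s) → begin
          (z - p) ^ (m ℕ.+ n) * (value f z r * value g z s)
            ≈⟨ *-cong (^-homo-* (z - p) m n) ≈-refl ⟩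
          ((z - p) ^ m * (z - p) ^ n) * (value f z r * value g z s)
            ≈⟨ regroup ((z - p) ^ m) ((z - p) ^ n) (value f z r) (value g z s) ⟩
          ((z - p) ^ m * value f z r) * ((z - p) ^ n * value g z s)
            ≈⟨ *-cong (extends P z (left b) z#p r) (extends Q z (right b) z#p s) ⟩
          value (extension P) z (left b) * value (extension Q) z (right b)
            ∎ }
      where
      open import Relation.Binary.Reasoning.Setoid (CommutativeRing.setoid commutativeRing)
      regroup : ∀ a b x y → (a * b) * (x * y) ≈ (a * x) * (b * y)
      regroup = solve 4 (λ a b x y → (a :* b) :* (x :* y) := (a :* x) :* (b :* y)) ≈-refl
        where open Solver

  scale-polar : ∀ {D p} {f : Holomorphic D} c → AtMostPole f p → AtMostPole (c ·ʰ f) p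
  scale-polar {p = p} {f} c P = record
    { radius = radius P ; radius-pos = radius-pos P ; punctured = punctured P
    ; order = order P ; extension = c ·ʰ extension P
    ; extends = λ z b z#p r → ≈-trans
        (solve 3 (λ a c x → a :* (c :* x) := c :* (a :* x)) ≈-refl ((z - p) ^ order P) c (value f z r))
        (*-cong ≈-refl (extends P z b z#p r)) }
    where open Solver

  -- If (z - p)^m f = g then (z - p)^(m+1) f′ = (z - p) g′ - m g.
  ∂-polar : ∀ {D p} {f : Holomorphic D} → Open D → AtMostPole f p → AtMostPole (∂ f) p
  ∂-polar {D} {p} {f} oD P = record
    { radius = radius P ; radius-pos = radius-pos P ; punctured = punctured P
    ; order = suc m ; extension = linear p *ʰ ∂ g +ʰ (- fromℕ m) ·ʰ g
    ; extends = λ z b z#p r → begin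
        ((z - p) * (z - p) ^ m) * jet f 1 z r
          ≈⟨ lem₁ (z - p) ((z - p) ^ m) (jet f 1 z r) (jet (power {V} p m) 1 z (b , z#p , r)) (value f z r) ⟩
        (z - p) * (jet (power {V} p m) 1 z (b , z#p , r) * value f z r + (z - p) ^ m * jet f 1 z r)
          + - (((z - p) * jet (power {V} p m) 1 z (b , z#p , r)) * value f z r)
          ≈⟨ +-cong (*-cong ≈-refl (≈-trans (+-cong ≈-refl (*-cong (≡⇒≈ (≡.sym (power-value {V} p m z (b , z#p , r)))) ≈-refl))
                                            (derivatives z (b , z#p , r))))
                    (-‿cong (*-cong (power-deriv {V} p m z (b , z#p , r)) ≈-refl)) ⟩
        (z - p) * jet g 1 z b + - ((fromℕ m * (z - p) ^ m) * value f z r)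
          ≈⟨ lem₂ ((z - p) * jet g 1 z b) (fromℕ m) ((z - p) ^ m) (value f z r) ⟩
        (z - p) * jet g 1 z b + - fromℕ m * ((z - p) ^ m * value f z r)
          ≈⟨ +-cong ≈-refl (*-cong ≈-refl (extends P z b z#p r)) ⟩
        (z - p) * jet g 1 z b + - fromℕ m * value g z b
          ∎ }
    where
    open import Relation.Binary.Reasoning.Setoid (CommutativeRing.setoid commutativeRing)
    open CommutativeRing commutativeRing using () renaming (reflexive to ≡⇒≈)
    m = order P
    g = extension P
    V : Pred ℂ 0ℓ
    V = Ball p (radius P) ∩ ((_# p) ∩ D)
    oV : Open V
    oV = open-∩ (open-ball p (radius-pos P)) (open-∩ (open-# p) oD)
    f↾ g↾ : Holomorphic V
    f↾ = restrict (λ r → proj₂ (proj₂ r)) f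
    g↾ = restrict proj₁ g
    derivatives : ∀ z (v : z ∈ V) → jet (power {V} p m *ʰ f↾) 1 z v ≈ jet g↾ 1 z v
    derivatives = unique oV (jet-deriv (power p m *ʰ f↾) 0) (jet-deriv g↾ 0)
      (λ z (b , z#p , r) → ≈-trans (*-cong (≡⇒≈ (power-value {V} p m z (b , z#p , r))) ≈-refl) (extends P z b z#p r))
    lem₁ : ∀ a v d e x → (a * v) * d ≈ a * (e * x + v * d) + - ((a * e) * x)
    lem₁ = solve 5 (λ a v d e x → (a :* v) :* d := a :* (e :* x :+ v :* d) :+ :- ((a :* e) :* x)) ≈-refl
      where open Solver
    lem₂ : ∀ y n v x → y + - ((n * v) * x) ≈ y + - n * (v * x)
    lem₂ = solve 4 (λ y n v x → y :+ :- ((n :* v) :* x) := y :+ :- n :* (v :* x)) ≈-refl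
      where open Solver

infixl 6 _⊕_
infixl 7 _⊛_ _·_

𝟘 : ∀ {D} → Meromorphic D
𝟘 {D} .regular      = set D
𝟘 {D} .regular-open = isOpen D
𝟘 .regular⊆     r   = r
𝟘 .holomorphic  = Hol.const 0ᶜ
𝟘 {D} .polar p p∈D  = Polar.zero-polar (isOpen D) p∈D

_⊕_ : ∀ {D} → Meromorphic D → Meromorphic D → Meromorphic D
(f ⊕ g) .regular      = regular f ∩ regular g
(f ⊕ g) .regular-open = open-∩ (regular-open f) (regular-open g)
(f ⊕ g) .regular⊆ r   = regular⊆ f (proj₁ r)
(f ⊕ g) .holomorphic  = Hol.restrict proj₁ (holomorphic f) Hol.+ʰ Hol.restrict proj₂ (holomorphic g)
(f ⊕ g) .polar p p∈D  = Polar.+-polar (polar f p p∈D) (polar g p p∈D)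

_⊛_ : ∀ {D} → Meromorphic D → Meromorphic D → Meromorphic D
(f ⊛ g) .regular      = regular f ∩ regular g
(f ⊛ g) .regular-open = open-∩ (regular-open f) (regular-open g)
(f ⊛ g) .regular⊆ r   = regular⊆ f (proj₁ r)
(f ⊛ g) .holomorphic  = Hol.restrict proj₁ (holomorphic f) Hol.*ʰ Hol.restrict proj₂ (holomorphic g)
(f ⊛ g) .polar p p∈D  = Polar.*-polar (polar f p p∈D) (polar g p p∈D)

_·_ : ∀ {D} → ℂ → Meromorphic D → Meromorphic D
(c · f) .regular      = regular f
(c · f) .regular-open = regular-open f
(c · f) .regular⊆     = regular⊆ f
(c · f) .holomorphic  = c Hol.·ʰ holomorphic f
(c · f) .polar p p∈D  = Polar.scale-polar c (polar f p p∈D)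

d/dz : ∀ {D} → Meromorphic D → Meromorphic D
d/dz f .regular      = regular f
d/dz f .regular-open = regular-open f
d/dz f .regular⊆     = regular⊆ f
d/dz f .holomorphic  = Hol.∂ (holomorphic f)
d/dz f .polar p p∈D  = Polar.∂-polar (regular-open f) (polar f p p∈D)

plane : OpenSet
plane .set        = U
plane .isOpen _ _ = 1ℚ , 0<1 , λ _ → tt

_↾_ : Meromorphic plane → (D : OpenSet) → Meromorphic D
(u ↾ D) .regular      = regular u ∩ set D
(u ↾ D) .regular-open = open-∩ (regular-open u) (isOpen D)
(u ↾ D) .regular⊆     = proj₂
(u ↾ D) .holomorphic  = Hol.restrict proj₁ (holomorphic u)
(u ↾ D) .polar p p∈D  = Polar.restrict-polar (isOpen D) p∈D (polar u p tt)

record Domain : Set₁ where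
  field
    openSet   : OpenSet
    inhabited : Satisfiable (set openSet)
    connected : ∀ (V W : Pred ℂ 0ℓ) → Open V → Open W → set openSet ⊆ V ∪ W →
                Satisfiable (set openSet ∩ V) → Satisfiable (set openSet ∩ W) →
                Satisfiable (set openSet ∩ (V ∩ W))
open Domain public

Operator : OpenSet → Set₁
Operator D = Meromorphic D → Meromorphic D

-- u(z) d/dz, acting on meromorphic functions on D
A⟨_⟩ : Meromorphic plane → ∀ {D} → Operator D
A⟨ u ⟩ {D} f = (u ↾ D) ⊛ d/dz f

-- a + bL
affine : ∀ {D} → ℂ → ℂ → Operator D → Operator D
affine a b L f = a · f ⊕ b · L f

⊕-rawMonoid : OpenSet → RawMonoid (Level.suc 0ℓ) 0ℓ
⊕-rawMonoid D = record { Carrier = Meromorphic D ; _≈_ = _≋_ ; _∙_ = _⊕_ ; ε = 𝟘 }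

-- P(w) and P(L), for P with coefficients c 0, c 1, …
evalℂ : ∀ {n} → Vector ℂ n → ℂ → ℂ
evalℂ c w = sum (λ t → c t * w ^ toℕ t)
  where open Sum (CommutativeRing.semiring Complex.commutativeRing) using (sum)

evalOp : ∀ {n D} → Vector ℂ n → Operator D → Operator D
evalOp {D = D} c L f = sum (λ t → c t · (L Lᵗ.^ toℕ t) f)
  where
  module Lᵗ = Endo (Meromorphic D)
  open RawMonoidDefinitions (⊕-rawMonoid D) using (sum)

{-# OPTIONS --safe #-}
module Submission where

open import Algebra.Bundles using (CommutativeRing)
import Algebra.Definitions.RawMonoid as RawMonoidDefinitions
import Algebra.Properties.Semiring.Exp as Exp
import Algebra.Properties.Semiring.Sum as Sum
open import Data.Fin.Base using (toℕ; zero; suc)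
open import Data.Nat.Base using (ℕ; zero; suc)
open import Data.Product.Base using (_,_)
open import Data.Rational.Base using (0ℚ; 1ℚ)
open import Data.Vec.Functional using (Vector)
import Function.Endo.Propositional as Endo
import Relation.Binary.Reasoning.Setoid
open import Relation.Unary using (_∈_)
open import Defs
open Complex using (ℂ; _+_; _*_)
open Complex hiding (ℂ; _+_; _*_)
open Calculus using (unique; deriv-restrict; open-∩)
open Exp (CommutativeRing.semiring commutativeRing) using (_^_)
open Sum (CommutativeRing.semiring commutativeRing) using (sum)
open Relation.Binary.Reasoning.Setoid (CommutativeRing.setoid commutativeRing)

-- Since A is linear over ℂ and A y = μ y, any f equal to p y satisfies
-- (a + b A) f = (a + b μ) p y.  Hence (a + b A)^t y = (a + b μ)^t y, and P is
-- applied termwise.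

-- By the linearity of `A⟨ u ⟩`, applying a + bA to a multiple of y multiplies it by a + bμ, so
-- iterating gives powers and summing gives P. The analytic input is that `d/dz` respects `_≋_`
-- (`d/dz-cong`): an iterate is only known to equal p y in value, and A looks at its derivative. The
-- claims all compare some f with a multiple p · y, at points regular for both f and y. Each
-- intermediate function used is therefore regular there, and no general transitivity of `_≋_` is
-- called for.

-- The difference quotient estimate with w = z forces f z s = f z r.
value-irrelevant : ∀ {D} (f : Holomorphic D) z (r s : z ∈ D) → value f z r ≈ value f z s
value-irrelevant f z r s with approx (jet-deriv f 0) z s 1ℚ Rational.0<1
... | δ , 0<δ , close = begin
  value f z r                                                        ≈⟨ recover (value f z r) (value f z s) (jet f 1 z s) z ⟩
  (value f z r - value f z s - jet f 1 z s * (z - z)) + value f z s  ≈⟨ +-cong (∣∣²-zero err≤0) ≈-refl ⟩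
  0ᶜ + value f z s                                                   ≈⟨ +-identityˡ (value f z s) ⟩
  value f z s                                                        ∎
  where
  recover : ∀ x y d z → x ≈ (x - y - d * (z - z)) + y
  recover = solve 4 (λ x y d z → x := (x :- y :- d :* (z :- z)) :+ y) ≈-refl
    where open Solver
  ∣z-z∣²≈0 : ∣ z - z ∣² Real.≈ Real.0ᴿ
  ∣z-z∣²≈0 = Real.≈-trans (∣∣²-cong (+-inverseʳ z)) (∣∣²-ι 0ℚ)
  z∈ball : z ∈ Ball z δ
  z∈ball = Real.≤-<-trans (Real.≤-reflexive ∣z-z∣²≈0) (Real.ι-mono-< (Rational.*-pos 0<δ 0<δ))
  err≤0 : ∣ value f z r - value f z s - jet f 1 z s * (z - z) ∣² Real.≤ Real.0ᴿ
  err≤0 = Real.≤-trans (close z r z∈ball)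
    (Real.≤-reflexive (Real.≈-trans (Real.*-identityˡ ∣ z - z ∣²) ∣z-z∣²≈0))

-- On the common regular set, which is open, the two functions agree at every point, and derivatives
-- on an open set are determined by the values. The stored jets of f and g need not match a priori.
d/dz-cong : ∀ {D} {f g : Meromorphic D} → f ≋ g → d/dz f ≋ d/dz g
d/dz-cong {f = f} {g} f≋g z r s =
  unique (open-∩ (regular-open f) (regular-open g))
    (deriv-restrict (λ (r , _) → r) (jet-deriv (holomorphic f) 0))
    (deriv-restrict (λ (_ , s) → s) (jet-deriv (holomorphic g) 0))
    (λ z (r , s) → f≋g z r s) z (r , s)

sum-multiples : ∀ {D n} {y : Meromorphic D} (f : Vector (Meromorphic D) n) (p : Vector ℂ n) →
  (∀ t → f t ≋ p t · y) → RawMonoidDefinitions.sum (⊕-rawMonoid D) f ≋ sum p · y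
sum-multiples {n = zero} {y} f p f≋py z r s = zeroed (value (holomorphic y) z s)
  where
  zeroed : ∀ x → 0ᶜ ≈ 0ᶜ * x
  zeroed = solve 1 (λ x → con 0ℚ := con 0ℚ :* x) ≈-refl
    where open Solver
sum-multiples {n = suc n} {y} f p f≋py z (r , rs) s = ≈-trans
  (+-cong (f≋py zero z r s)
          (sum-multiples {y = y} (λ t → f (suc t)) (λ t → p (suc t)) (λ t → f≋py (suc t)) z rs s))
  (≈-sym (distribʳ (value (holomorphic y) z s) (p zero) (sum (λ t → p (suc t)))))

module _ (u : Meromorphic plane) (μ : ℂ) {D : OpenSet} (y : Meromorphic D)
         (Ay≋μy : A⟨ u ⟩ y ≋ μ · y) where

  -- Here f is arbitrary because the iterates equal multiples of y only up to `_≋_`, so p · y cannot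
  -- be substituted for them.
  A-multiple : ∀ {f p} → f ≋ p · y → A⟨ u ⟩ f ≋ (p * μ) · y
  A-multiple {f} {p} f≋py z (ru , rf) s = begin
    U * jet (holomorphic f) 1 z rf  ≈⟨ *-cong ≈-refl (d/dz-cong {f = f} {p · y} f≋py z rf s) ⟩
    U * (p * Y′)                    ≈⟨ swap U p Y′ ⟩
    -- A y is regular where both u and y are, so `s` serves for both sides of the hypothesis.
    p * (U * Y′)                    ≈⟨ *-cong ≈-refl (Ay≋μy z (ru , s) s) ⟩
    p * (μ * Y)                     ≈⟨ *-assoc p μ Y ⟨
    p * μ * Y                       ∎
    where
    U  = value (holomorphic (u ↾ D)) z ru
    Y  = value (holomorphic y) z s
    Y′ = jet (holomorphic y) 1 z s
    swap : ∀ a b c → a * (b * c) ≈ b * (a * c)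
    swap = solve 3 (λ a b c → a :* (b :* c) := b :* (a :* c)) ≈-refl
      where open Solver

  module _ (a b : ℂ) where

    open Endo (Meromorphic D) using () renaming (_^_ to _^ᵒ_)

    -- The induction step for powers; the new factor stands on the left to match the unfolding of
    -- `_^_` at a successor.
    affine-multiple : ∀ {f p} → f ≋ p · y → affine a b A⟨ u ⟩ f ≋ ((a + b * μ) * p) · y
    affine-multiple {f} {p} f≋py z (rf , rA) s = ≈-trans
      (+-cong (*-cong ≈-refl (f≋py z rf s)) (*-cong ≈-refl (A-multiple {f} {p} f≋py z rA s)))
      (collect a b μ p (value (holomorphic y) z s))
      where
      collect : ∀ a b μ p x → a * (p * x) + b * (p * μ * x) ≈ (a + b * μ) * p * x
      collect = solve 5 (λ a b μ p x → a :* (p :* x) :+ b :* (p :* μ :* x) := (a :+ b :* μ) :* p :* x) ≈-refl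
        where open Solver

    affine^-multiple : ∀ t → (affine a b A⟨ u ⟩ ^ᵒ t) y ≋ (a + b * μ) ^ t · y
    -- The zeroth iterate is y itself, but `r` and `s` may be different proofs of regularity at z.
    affine^-multiple zero    z r s =
      ≈-trans (value-irrelevant (holomorphic y) z r s) (≈-sym (*-identityˡ _))
    affine^-multiple (suc t) =
      affine-multiple {(affine a b A⟨ u ⟩ ^ᵒ t) y} {(a + b * μ) ^ t} (affine^-multiple t)

theorem1p2 : (u : Meromorphic plane) (n : ℕ) (c : Vector ℂ (suc n)) (μ : ℂ)
    (D : Domain) (y : Meromorphic (openSet D)) →
    A⟨ u ⟩ y ≋ μ · y →
    (a b : ℂ) → evalOp c (affine a b A⟨ u ⟩) y ≋ evalℂ c (a + b * μ) · y
theorem1p2 u n c μ D y Ay≋μy a b = sum-multiples {y = y}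
  -- With these summands and multipliers the two sums are `evalOp` and `evalℂ` by definition.
  (λ t → c t · (affine a b A⟨ u ⟩ ^ᵒ toℕ t) y)
  (λ t → c t * (a + b * μ) ^ toℕ t)
  (λ t z r s → ≈-trans
    (*-cong ≈-refl (affine^-multiple u μ y Ay≋μy a b (toℕ t) z r s))
    (≈-sym (*-assoc (c t) _ _)))
  where open Endo (Meromorphic (openSet D)) using () renaming (_^_ to _^ᵒ_)
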